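{- Let $P\in\mathbb{Z}[x]$ be a monic polynomial of degree $d$ with roots $\alpha_1,\dots,\alpha_d$. For every integer $n>1$, $\Psi_n(P)$ is the square of an integer.
   Context: $\Phi_n$ denotes the $n$-th cyclotomic polynomial and $\phi$ Euler's totient function. Define $\Psi_n(P):=\prod_{1\le j<k\le d}\Big(\alpha_k^{\phi(n)}\Phi_n\big(\tfrac{\alpha_j}{\alpha_k}\big)\Big)^2$, where $\alpha_k^{\phi(n)}\Phi_n(\alpha_j/\alpha_k)$ means the homogeneous expression $\prod_{\zeta}(\alpha_j-\zeta\alpha_k)$, the product over primitive $n$-th roots of unity $\zeta$. -}

module Defs where

open import Level using (Level; _⊔_)
open import Algebra.Bundles using (CommutativeRing)
open import Data.Nat as ℕ using (ℕ; zero; suc; _<_)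
open import Data.Nat.GCD using (gcd)
open import Data.Integer as ℤ using (ℤ; +_; -[1+_])
open import Data.List as List using (List; []; _∷_; map; filter; foldr; _++_; upTo)
open import Data.List.Relation.Binary.Pointwise using (Pointwise)
open import Data.Vec as Vec using (Vec)
open import Data.Fin using (Fin)
open import Data.Product using (_×_; _,_; ∃; Σ)
open import Relation.Nullary using (¬_)
open import Relation.Binary.PropositionalEquality using (_≡_)

module _ {c ℓ : Level} (R : CommutativeRing c ℓ) where
  open CommutativeRing R

  fromℕ : ℕ → Carrier
  fromℕ zero    = 0#
  fromℕ (suc m) = 1# + fromℕ m

  fromℤ : ℤ → Carrier
  fromℤ (+ m)      = fromℕ m
  fromℤ -[1+ m ]   = - fromℕ (suc m)

  pow : Carrier → ℕ → Carrier
  pow x zero    = 1#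
  pow x (suc k) = x * pow x k

  prod : List Carrier → Carrier
  prod = foldr _*_ 1#

  IsField : Set (c ⊔ ℓ)
  IsField = (¬ (1# ≈ 0#)) × (∀ x → ¬ (x ≈ 0#) → ∃ λ y → (x * y) ≈ 1#)

  CharZero : Set ℓ
  CharZero = ∀ m → ¬ (fromℕ (suc m) ≈ 0#)

  IsPrimitiveRoot : ℕ → Carrier → Set ℓ
  IsPrimitiveRoot n ω = (pow ω n ≈ 1#) × (∀ k → 0 < k → k < n → ¬ (pow ω k ≈ 1#))

  -- polynomials as coefficient lists, lowest degree first
  addP : List Carrier → List Carrier → List Carrier
  addP []       q        = q
  addP (a ∷ p)  []       = a ∷ p
  addP (a ∷ p)  (b ∷ q)  = (a + b) ∷ addP p q

  mulXsub : Carrier → List Carrier → List Carrier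
  mulXsub a p = addP (0# ∷ p) (map (λ u → (- a) * u) p)

  rootPoly : List Carrier → List Carrier
  rootPoly []       = 1# ∷ []
  rootPoly (a ∷ as) = mulXsub a (rootPoly as)

  -- the image in R[x] of the monic integer polynomial
  -- x^d + c₀ + c₁ x + … + c_{d-1} x^{d-1}
  monicPoly : ∀ {d} → Vec ℤ d → List Carrier
  monicPoly cs = map fromℤ (Vec.toList cs) ++ (1# ∷ [])

  AreRoots : ∀ {d} → Vec ℤ d → Vec Carrier d → Set (c ⊔ ℓ)
  AreRoots cs α = Pointwise _≈_ (monicPoly cs) (rootPoly (Vec.toList α))

  pairs : List Carrier → List (Carrier × Carrier)
  pairs []       = []
  pairs (a ∷ as) = map (a ,_) as ++ pairs as

  -- exponents 1 ≤ k ≤ n with gcd(k,n) = 1; ω^k runs over the primitive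
  -- n-th roots of unity when ω is one
  coprimeExps : ℕ → List ℕ
  coprimeExps n = filter (λ k → gcd k n ℕ.≟ 1) (map suc (upTo n))

  -- homogeneous αₖ^{φ(n)} Φₙ(αⱼ/αₖ) = ∏_ζ (αⱼ - ζ αₖ)
  homCyc : ℕ → Carrier → Carrier → Carrier → Carrier
  homCyc n ω a b = prod (map (λ k → a - (pow ω k * b)) (coprimeExps n))

  -- Ψₙ(P) = ∏_{j<k} (αₖ^{φ(n)} Φₙ(αⱼ/αₖ))²
  Ψ : ℕ → Carrier → List Carrier → Carrier
  Ψ n ω α = prod (map (λ { (a , b) → homCyc n ω a b * homCyc n ω a b }) (pairs α))

{-# OPTIONS --safe #-}
-- Put R = ∏_{j<k} ∏_ζ (αⱼ - ζ αₖ), so that Ψ = R². For n > 1 the binary form ∏_ζ (x - ζ y) is symmetric in x and y,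
-- hence each power Rᵗ is symmetric in the α's as well as in the ζ's. Summing the integer polynomial Rᵗ over all
-- permutations of both families therefore gives d! φ(n)! Rᵗ; eliminating the variables one at a time, such a sum becomes
-- an integer polynomial in the power sums of the α's (integers by Newton's identities) and of the ζ's (Ramanujan sums,
-- integers by inclusion-exclusion over the divisors of n). So all powers of R are rational with the common
-- denominator d! φ(n)!, which forces R to be an integer. No integrality of the coefficients of Φₙ is needed.
module Submission where

open import Defs
open import Level using (Level; _⊔_)
open import Algebra.Bundles using (CommutativeRing; CommutativeMonoid)
open import Data.Nat as ℕ using (ℕ; zero; suc; _<_; _≤_; _∸_; z≤n; s≤s; _!; NonZero)
import Data.Nat.Properties as ℕₚ
open import Data.Nat.Divisibility using (_∣_; divides; _∣?_; ∣-trans; ∣-refl; ∣⇒≤; ∣1⇒≡1; *-cancelʳ-∣; *-monoˡ-∣; ∣m∣n⇒∣m+n; ∣m+n∣m⇒∣n)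
open import Data.Nat.Coprimality as Coprimality using (Coprime; coprime-divisor)
open import Data.Nat.GCD using (gcd; gcd[m,n]∣m; gcd[m,n]∣n; gcd-greatest)
open import Data.Nat.LCM using (lcm; lcm-least; m∣lcm[m,n]; n∣lcm[m,n])
open import Data.Integer as ℤ using (ℤ; +_; -[1+_])
import Data.Integer.Properties as ℤₚ
open import Data.Vec using (Vec; toList)
open import Data.List using (List; []; _∷_; map; filter; foldr; _++_; upTo; applyUpTo; length)
import Data.List.Properties as Listₚ
open import Data.List.Membership.Propositional using (_∈_)
open import Data.List.Membership.Propositional.Properties using (∈-map⁻; ∈-filter⁺; ∈-filter⁻; ∈-upTo⁺; ∈-upTo⁻)
open import Data.List.Relation.Unary.Any using (here; there)
open import Data.List.Relation.Binary.Permutation.Propositional using (_↭_; prep; swap; ↭-sym; ↭-trans)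
import Data.List.Relation.Binary.Permutation.Propositional as Perm
import Data.List.Relation.Binary.Permutation.Propositional.Properties as Permₚ
open import Data.Product using (∃; _×_; _,_; proj₁; proj₂)
open import Data.Sum using (_⊎_; inj₁; inj₂)
open import Data.Empty using (⊥-elim)
open import Data.Maybe using (Maybe; just; nothing)
open import Function using (_∘_; id)
open import Relation.Nullary using (¬_; Dec; yes; no)
open import Relation.Binary.PropositionalEquality as ≡ using (_≡_; refl; cong; cong₂; subst)
import Data.Integer.Divisibility.Signed as ℤ∣
open import Data.Nat.DivMod using (_%_; _/_; m≡m%n+[m/n]*n; m%n<n)
open import Relation.Nullary.Decidable using (_×-dec_; ¬?)
open import Data.List.Relation.Binary.Pointwise using (Pointwise; []; _∷_)

-- Summing over permutations avoids expressing symmetric polynomials through the elementary ones: a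
-- power sum over the values still unassigned is the power sum over all of them minus one power, so
-- every variable can be eliminated by rewriting alone. The price is the factor N = d! φ(n)!, which
-- cannot be divided out in the integers. The powers Rᵗ make up for it: one N serves for every t,
-- whereas the denominators of the powers of a non-integral rational number grow without bound. This
-- takes the place of the argument that a rational algebraic integer is an integer. The condition n
-- > 1 enters through the symmetry of the form; for n = 1 the form is x - y, which changes sign.
-- Equality in K need not be decidable. Whether a power of ω equals 1 is therefore decided on the
-- exponent modulo n, and entries are removed from lists by position.

-- Finite sums and products in a commutative monoid

module BigOperator {c ℓ : Level} (M : CommutativeMonoid c ℓ) where
  open CommutativeMonoid M renaming (refl to ≈-refl; sym to ≈-sym; trans to ≈-trans)
  open import Algebra.Properties.CommutativeSemigroup commutativeSemigroup public using (interchange)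
  open import Relation.Binary.Reasoning.Setoid setoid

  ⨁ : ∀ {a} {A : Set a} → List A → (A → Carrier) → Carrier
  ⨁ []       f = ε
  ⨁ (x ∷ xs) f = f x ∙ ⨁ xs f

  guarded : ∀ {p} {P : Set p} → Dec P → Carrier → Carrier
  guarded (yes _) x = x
  guarded (no _)  x = ε

  module _ {a} {A : Set a} where

    ⨁-cong-∈ : ∀ (xs : List A) {f g : A → Carrier} → (∀ {x} → x ∈ xs → f x ≈ g x) → ⨁ xs f ≈ ⨁ xs g
    ⨁-cong-∈ []       f≈g = ≈-refl
    ⨁-cong-∈ (x ∷ xs) f≈g = ∙-cong (f≈g (here refl)) (⨁-cong-∈ xs (f≈g ∘ there))

    ⨁-cong : ∀ (xs : List A) {f g : A → Carrier} → (∀ x → f x ≈ g x) → ⨁ xs f ≈ ⨁ xs g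
    ⨁-cong xs f≈g = ⨁-cong-∈ xs (λ {x} _ → f≈g x)

    ⨁-ε : ∀ (xs : List A) → ⨁ xs (λ _ → ε) ≈ ε
    ⨁-ε []       = ≈-refl
    ⨁-ε (x ∷ xs) = ≈-trans (identityˡ _) (⨁-ε xs)

    ⨁-∙ : ∀ (xs : List A) (f g : A → Carrier) → ⨁ xs (λ x → f x ∙ g x) ≈ ⨁ xs f ∙ ⨁ xs g
    ⨁-∙ []       f g = ≈-sym (identityˡ ε)
    ⨁-∙ (x ∷ xs) f g = ≈-trans (∙-congˡ (⨁-∙ xs f g)) (interchange _ _ _ _)

    ⨁-++ : ∀ (xs ys : List A) (f : A → Carrier) → ⨁ (xs ++ ys) f ≈ ⨁ xs f ∙ ⨁ ys f
    ⨁-++ []       ys f = ≈-sym (identityˡ _)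
    ⨁-++ (x ∷ xs) ys f = ≈-trans (∙-congˡ (⨁-++ xs ys f)) (≈-sym (assoc _ _ _))

    ⨁-↭ : ∀ {xs ys : List A} (f : A → Carrier) → xs ↭ ys → ⨁ xs f ≈ ⨁ ys f
    ⨁-↭ f Perm.refl        = ≈-refl
    ⨁-↭ f (prep x p)       = ∙-congˡ (⨁-↭ f p)
    ⨁-↭ f (swap {xs} {ys} x y p) = begin
      f x ∙ (f y ∙ ⨁ xs f)  ≈⟨ assoc _ _ _ ⟨
      (f x ∙ f y) ∙ ⨁ xs f  ≈⟨ ∙-cong (comm _ _) (⨁-↭ f p) ⟩
      (f y ∙ f x) ∙ ⨁ ys f  ≈⟨ assoc _ _ _ ⟩
      f y ∙ (f x ∙ ⨁ ys f)  ∎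
    ⨁-↭ f (Perm.trans p q) = ≈-trans (⨁-↭ f p) (⨁-↭ f q)

    ⨁-map : ∀ {b} {B : Set b} (h : B → A) (xs : List B) (f : A → Carrier) → ⨁ (map h xs) f ≡ ⨁ xs (f ∘ h)
    ⨁-map h []       f = refl
    ⨁-map h (x ∷ xs) f = cong (f (h x) ∙_) (⨁-map h xs f)

    ⨁-foldr : ∀ (xs : List A) (f : A → Carrier) → foldr _∙_ ε (map f xs) ≡ ⨁ xs f
    ⨁-foldr []       f = refl
    ⨁-foldr (x ∷ xs) f = cong (f x ∙_) (⨁-foldr xs f)

    -- Moves the condition from the index list into the summand, so that the full range of indices
    -- remains and can be shifted or reflected.
    ⨁-filter : ∀ {p} {P : A → Set p} (P? : ∀ x → Dec (P x)) (xs : List A) (f : A → Carrier) →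
               ⨁ (filter P? xs) f ≈ ⨁ xs (λ x → guarded (P? x) (f x))
    ⨁-filter P? []       f = ≈-refl
    ⨁-filter P? (x ∷ xs) f with P? x
    ... | yes _ = ∙-congˡ (⨁-filter P? xs f)
    ... | no  _ = ≈-trans (⨁-filter P? xs f) (≈-sym (identityˡ _))

  ⨁-swap : ∀ {a b} {A : Set a} {B : Set b} (xs : List A) (ys : List B) (f : A → B → Carrier) →
           ⨁ xs (λ x → ⨁ ys (f x)) ≈ ⨁ ys (λ y → ⨁ xs (λ x → f x y))
  ⨁-swap []       ys f = ≈-sym (⨁-ε ys)
  ⨁-swap (x ∷ xs) ys f = ≈-trans (∙-congˡ (⨁-swap xs ys f)) (≈-sym (⨁-∙ ys (f x) _))

  -- Indexing by numbers instead of list entries makes it easy to split off the last term, on which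
  -- reversal and cyclic shifts rest.
  ⨁< : ℕ → (ℕ → Carrier) → Carrier
  ⨁< zero    u = ε
  ⨁< (suc n) u = u 0 ∙ ⨁< n (u ∘ suc)

  ⨁<-cong : ∀ n {u v : ℕ → Carrier} → (∀ i → i < n → u i ≈ v i) → ⨁< n u ≈ ⨁< n v
  ⨁<-cong zero    u≈v = ≈-refl
  ⨁<-cong (suc n) u≈v = ∙-cong (u≈v 0 (s≤s z≤n)) (⨁<-cong n (λ i i<n → u≈v (suc i) (s≤s i<n)))

  ⨁-applyUpTo : ∀ {a} {A : Set a} (h : ℕ → A) n (f : A → Carrier) → ⨁ (applyUpTo h n) f ≡ ⨁< n (f ∘ h)
  ⨁-applyUpTo h zero    f = refl
  ⨁-applyUpTo h (suc n) f = cong (f (h 0) ∙_) (⨁-applyUpTo (h ∘ suc) n f)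

  ⨁<-last : ∀ n u → ⨁< (suc n) u ≈ ⨁< n u ∙ u n
  ⨁<-last zero    u = comm _ _
  ⨁<-last (suc n) u = ≈-trans (∙-congˡ (⨁<-last n (u ∘ suc))) (≈-sym (assoc _ _ _))

  ⨁<-reverse : ∀ n u → ⨁< n (λ i → u (n ∸ suc i)) ≈ ⨁< n u
  ⨁<-reverse zero    u = ≈-refl
  ⨁<-reverse (suc n) u = begin
    u n ∙ ⨁< n (λ i → u (n ∸ suc i))  ≈⟨ ∙-congˡ (⨁<-reverse n u) ⟩
    u n ∙ ⨁< n u                      ≈⟨ comm _ _ ⟩
    ⨁< n u ∙ u n                      ≈⟨ ⨁<-last n u ⟨
    ⨁< (suc n) u                      ∎

-- The ring homomorphism from the integers, and a ring solver with integer coefficients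

module RingLemmas {c ℓ : Level} (K : CommutativeRing c ℓ) where
  open CommutativeRing K renaming (refl to ≈-refl; sym to ≈-sym; trans to ≈-trans) public
  open import Relation.Binary.Reasoning.Setoid setoid
  open import Algebra.Properties.Ring ring public
    using (-‿distribˡ-*; -‿distribʳ-*; -‿involutive; -0#≈0#; -‿+-comm; +-cancelˡ)

  fromℕ-+ : ∀ m n → fromℕ K (m ℕ.+ n) ≈ fromℕ K m + fromℕ K n
  fromℕ-+ zero    n = ≈-sym (+-identityˡ _)
  fromℕ-+ (suc m) n = ≈-trans (+-congˡ (fromℕ-+ m n)) (≈-sym (+-assoc _ _ _))

  fromℕ-* : ∀ m n → fromℕ K (m ℕ.* n) ≈ fromℕ K m * fromℕ K n
  fromℕ-* zero    n = ≈-sym (zeroˡ _)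
  fromℕ-* (suc m) n = begin
    fromℕ K (n ℕ.+ m ℕ.* n)                      ≈⟨ fromℕ-+ n (m ℕ.* n) ⟩
    fromℕ K n + fromℕ K (m ℕ.* n)                ≈⟨ +-cong (≈-sym (*-identityˡ _)) (fromℕ-* m n) ⟩
    1# * fromℕ K n + fromℕ K m * fromℕ K n       ≈⟨ distribʳ _ _ _ ⟨
    (1# + fromℕ K m) * fromℕ K n                 ∎

  fromℤ-neg : ∀ i → fromℤ K (ℤ.- i) ≈ - fromℤ K i
  fromℤ-neg (+ zero)  = ≈-sym -0#≈0#
  fromℤ-neg (+ suc n) = ≈-refl
  fromℤ-neg -[1+ n ]  = ≈-sym (-‿involutive _)

  fromℤ-⊖ : ∀ m n → fromℤ K (m ℤ.⊖ n) ≈ fromℕ K m - fromℕ K n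
  fromℤ-⊖ m       zero    = ≈-sym (≈-trans (+-congˡ -0#≈0#) (+-identityʳ _))
  fromℤ-⊖ zero    (suc n) = ≈-sym (+-identityˡ _)
  fromℤ-⊖ (suc m) (suc n) = begin
    fromℤ K (suc m ℤ.⊖ suc n)                  ≡⟨ cong (fromℤ K) (ℤₚ.[1+m]⊖[1+n]≡m⊖n m n) ⟩
    fromℤ K (m ℤ.⊖ n)                          ≈⟨ fromℤ-⊖ m n ⟩
    fromℕ K m - fromℕ K n                      ≈⟨ +-identityˡ _ ⟨
    0# + (fromℕ K m - fromℕ K n)               ≈⟨ +-congʳ (-‿inverseʳ 1#) ⟨
    (1# - 1#) + (fromℕ K m - fromℕ K n)        ≈⟨ interchange 1# (- 1#) (fromℕ K m) (- fromℕ K n) ⟩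
    (1# + fromℕ K m) + (- 1# - fromℕ K n)      ≈⟨ +-congˡ (-‿+-comm _ _) ⟩
    (1# + fromℕ K m) - (1# + fromℕ K n)        ∎
    where open BigOperator +-commutativeMonoid using (interchange)

  fromℤ-+ : ∀ i j → fromℤ K (i ℤ.+ j) ≈ fromℤ K i + fromℤ K j
  fromℤ-+ (+ m)    (+ n)    = fromℕ-+ m n
  fromℤ-+ (+ m)    -[1+ n ] = fromℤ-⊖ m (suc n)
  fromℤ-+ -[1+ m ] (+ n)    = ≈-trans (fromℤ-⊖ n (suc m)) (+-comm _ _)
  fromℤ-+ -[1+ m ] -[1+ n ] = begin
    - fromℕ K (suc (suc (m ℕ.+ n)))            ≡⟨ cong (λ k → - fromℕ K (suc k)) (ℕₚ.+-suc m n) ⟨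
    - fromℕ K (suc m ℕ.+ suc n)                ≈⟨ -‿cong (fromℕ-+ (suc m) (suc n)) ⟩
    - (fromℕ K (suc m) + fromℕ K (suc n))      ≈⟨ -‿+-comm _ _ ⟨
    - fromℕ K (suc m) - fromℕ K (suc n)        ∎

  fromℤ-*-pos : ∀ m n → fromℤ K (+ m ℤ.* + n) ≈ fromℕ K m * fromℕ K n
  fromℤ-*-pos m n = ≈-trans (reflexive (cong (fromℤ K) (≡.sym (ℤₚ.pos-* m n)))) (fromℕ-* m n)

  fromℤ-*-neg : ∀ i n → fromℤ K (i ℤ.* + n) ≈ fromℤ K i * fromℕ K n → fromℤ K (i ℤ.* ℤ.- (+ n)) ≈ fromℤ K i * - fromℕ K n
  fromℤ-*-neg i n eq = begin
    fromℤ K (i ℤ.* ℤ.- (+ n))    ≡⟨ cong (fromℤ K) (ℤₚ.neg-distribʳ-* i (+ n)) ⟨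
    fromℤ K (ℤ.- (i ℤ.* + n))    ≈⟨ fromℤ-neg (i ℤ.* + n) ⟩
    - fromℤ K (i ℤ.* + n)        ≈⟨ -‿cong eq ⟩
    - (fromℤ K i * fromℕ K n)    ≈⟨ -‿distribʳ-* _ _ ⟩
    fromℤ K i * - fromℕ K n      ∎

  fromℤ-*-posʳ : ∀ i n → fromℤ K (i ℤ.* + n) ≈ fromℤ K i * fromℕ K n
  fromℤ-*-posʳ (+ m)    n = fromℤ-*-pos m n
  fromℤ-*-posʳ -[1+ m ] n = begin
    fromℤ K (-[1+ m ] ℤ.* + n)         ≡⟨ cong (fromℤ K) (ℤₚ.neg-distribˡ-* (+ suc m) (+ n)) ⟨
    fromℤ K (ℤ.- (+ suc m ℤ.* + n))    ≈⟨ fromℤ-neg (+ suc m ℤ.* + n) ⟩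
    - fromℤ K (+ suc m ℤ.* + n)        ≈⟨ -‿cong (fromℤ-*-pos (suc m) n) ⟩
    - (fromℕ K (suc m) * fromℕ K n)    ≈⟨ -‿distribˡ-* _ _ ⟩
    - fromℕ K (suc m) * fromℕ K n      ∎

  fromℤ-* : ∀ i j → fromℤ K (i ℤ.* j) ≈ fromℤ K i * fromℤ K j
  fromℤ-* i (+ n)    = fromℤ-*-posʳ i n
  fromℤ-* i -[1+ n ] = fromℤ-*-neg i (suc n) (fromℤ-*-posʳ i (suc n))

  -- The integer coefficients of the ring solver; unlike fromℤ it sends 1 to 1# on the nose.
  coefficient : ℤ → Carrier
  coefficient (+ 1) = 1#
  coefficient i     = fromℤ K i

  coefficient≈fromℤ : ∀ i → coefficient i ≈ fromℤ K i
  coefficient≈fromℤ (+ 0)           = ≈-refl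
  coefficient≈fromℤ (+ 1)           = ≈-sym (+-identityʳ 1#)
  coefficient≈fromℤ (+ suc (suc _)) = ≈-refl
  coefficient≈fromℤ -[1+ _ ]        = ≈-refl

  open import Algebra.Solver.Ring.AlmostCommutativeRing using (fromCommutativeRing; _-Raw-AlmostCommutative⟶_)

  coefficientMorphism : ℤ.+-*-rawRing -Raw-AlmostCommutative⟶ fromCommutativeRing K
  coefficientMorphism = record
    { ⟦_⟧    = coefficient
    ; +-homo = λ i j → ≈-trans (coefficient≈fromℤ (i ℤ.+ j)) (≈-trans (fromℤ-+ i j)
                 (≈-sym (+-cong (coefficient≈fromℤ i) (coefficient≈fromℤ j))))
    ; *-homo = λ i j → ≈-trans (coefficient≈fromℤ (i ℤ.* j)) (≈-trans (fromℤ-* i j)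
                 (≈-sym (*-cong (coefficient≈fromℤ i) (coefficient≈fromℤ j))))
    ; -‿homo = λ i → ≈-trans (coefficient≈fromℤ (ℤ.- i)) (≈-trans (fromℤ-neg i) (-‿cong (≈-sym (coefficient≈fromℤ i))))
    ; 0-homo = ≈-refl
    ; 1-homo = ≈-refl
    }

  coefficient-≟ : ∀ i j → Maybe (coefficient i ≈ coefficient j)
  coefficient-≟ i j with i ℤ.≟ j
  ... | yes refl = just ≈-refl
  ... | no  _    = nothing

  open import Algebra.Solver.Ring ℤ.+-*-rawRing (fromCommutativeRing K) coefficientMorphism coefficient-≟ public
    using (solve; _:=_; _:+_; _:*_; _:-_; :-_; con)

-- Divisibility of powers of natural numbers

-- A common divisor d of m n and o is coprime to m, because any common divisor of d and m also
-- divides o; hence d divides n.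
coprime-*ˡ : ∀ {m n o} → Coprime m o → Coprime n o → Coprime (m ℕ.* n) o
coprime-*ˡ cm cn (d∣mn , d∣o) =
  cn (coprime-divisor (λ (e∣d , e∣m) → cm (e∣m , ∣-trans e∣d d∣o)) d∣mn , d∣o)

coprime-^ˡ : ∀ {m o} k → Coprime m o → Coprime (m ℕ.^ k) o
coprime-^ˡ zero    c (d∣1 , _) = ∣1⇒≡1 d∣1
coprime-^ˡ (suc k) c = coprime-*ˡ c (coprime-^ˡ k c)

^-distribʳ-* : ∀ k m n → (m ℕ.* n) ℕ.^ k ≡ m ℕ.^ k ℕ.* n ℕ.^ k
^-distribʳ-* zero    m n = refl
^-distribʳ-* (suc k) m n = ≡.trans (cong (m ℕ.* n ℕ.*_) (^-distribʳ-* k m n))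
  (ℕₚ.[m*n]*[o*p]≡[m*o]*[n*p] m n (m ℕ.^ k) (n ℕ.^ k))

n<2^n : ∀ n → n < 2 ℕ.^ n
n<2^n zero    = s≤s z≤n
n<2^n (suc n) = ℕₚ.<-≤-trans (s≤s (n<2^n n))
  (ℕₚ.≤-trans (ℕₚ.+-monoˡ-≤ (2 ℕ.^ n) (ℕₚ.m^n>0 2 n))
    (ℕₚ.≤-reflexive (cong (2 ℕ.^ n ℕ.+_) (≡.sym (ℕₚ.+-identityʳ _)))))

-- Writing N = q g and z = p g with g = gcd N z, the hypothesis yields q ^ N ∣ g ≤ N < 2 ^ N, so q = 1.
^-∣-^suc⇒∣ : ∀ N z .{{_ : NonZero N}} → N ℕ.^ N ∣ z ℕ.^ suc N → N ∣ z
^-∣-^suc⇒∣ N z N^N∣ with gcd[m,n]∣m N z | gcd[m,n]∣n N z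
... | divides q N≡qg | divides p z≡pg = conclude q N≡qg qᴺ∣g
  where
  g = gcd N z

  g≢0 : ¬ (g ≡ 0)
  g≢0 g≡0 = ℕ.≢-nonZero⁻¹ N (≡.trans N≡qg (≡.trans (cong (q ℕ.*_) g≡0) (ℕₚ.*-zeroʳ q)))

  instance
    g-nonZero : NonZero g
    g-nonZero = ℕ.≢-nonZero g≢0

    gᴺ-nonZero : NonZero (g ℕ.^ N)
    gᴺ-nonZero = ℕₚ.m^n≢0 g N

  g≤N : g ≤ N
  g≤N = ∣⇒≤ (gcd[m,n]∣m N z)

  q⊥p : Coprime q p
  q⊥p {d} (d∣q , d∣p) = ∣1⇒≡1 (*-cancelʳ-∣ g (subst (d ℕ.* g ∣_) (≡.sym (ℕₚ.*-identityˡ g))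
    (gcd-greatest (subst (d ℕ.* g ∣_) (≡.sym N≡qg) (*-monoˡ-∣ g d∣q))
                  (subst (d ℕ.* g ∣_) (≡.sym z≡pg) (*-monoˡ-∣ g d∣p)))))

  regroup : z ℕ.^ suc N ≡ (p ℕ.^ suc N ℕ.* g) ℕ.* g ℕ.^ N
  regroup = ≡.trans (cong (ℕ._^ suc N) z≡pg) (≡.trans (^-distribʳ-* (suc N) p g)
    (≡.sym (ℕₚ.*-assoc (p ℕ.^ suc N) g (g ℕ.^ N))))

  qᴺ∣ : q ℕ.^ N ∣ p ℕ.^ suc N ℕ.* g
  qᴺ∣ = *-cancelʳ-∣ (g ℕ.^ N) (≡.subst₂ _∣_
    (≡.trans (cong (ℕ._^ N) N≡qg) (^-distribʳ-* N q g)) regroup N^N∣)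

  -- The exponents N and N + 1 differ by one, so after cancelling gᴺ a single factor g is left
  -- beside the power of p; qᴺ is coprime to that power.
  qᴺ∣g : q ℕ.^ N ∣ g
  qᴺ∣g = coprime-divisor (coprime-^ˡ N (Coprimality.sym (coprime-^ˡ (suc N) (Coprimality.sym q⊥p)))) qᴺ∣

  conclude : ∀ q → N ≡ q ℕ.* g → q ℕ.^ N ∣ g → N ∣ z
  conclude 0 N≡0 _ = ⊥-elim (ℕ.≢-nonZero⁻¹ N N≡0)
  conclude 1 N≡g _ = subst (_∣ z) (≡.sym (≡.trans N≡g (ℕₚ.*-identityˡ g))) (gcd[m,n]∣n N z)
  conclude (suc (suc q)) _ qᴺ∣g = ⊥-elim (ℕₚ.<-irrefl refl
    (ℕₚ.<-≤-trans (n<2^n N) (ℕₚ.≤-trans (ℕₚ.^-monoˡ-≤ N (s≤s (s≤s z≤n)))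
      (ℕₚ.≤-trans (∣⇒≤ qᴺ∣g) g≤N))))

abs-^ : ∀ i k → ℤ.∣ i ℤ.^ k ∣ ≡ ℤ.∣ i ∣ ℕ.^ k
abs-^ i zero    = refl
abs-^ i (suc k) = ≡.trans (ℤₚ.abs-* i (i ℤ.^ k)) (cong (ℤ.∣ i ∣ ℕ.*_) (abs-^ i k))

-- Integers inside K, and bounded denominators

module Integrality {c ℓ : Level} (K : CommutativeRing c ℓ) where
  open RingLemmas K
  open import Relation.Binary.Reasoning.Setoid setoid
  open BigOperator +-commutativeMonoid using () renaming (⨁< to ∑<)

  -- The integer is kept as data: `substPsums` uses it as a coefficient, and it becomes the square
  -- root in the theorem.
  IsInt : Carrier → Set ℓ
  IsInt x = ∃ λ i → x ≈ fromℤ K i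

  Invertible : Carrier → Set (c ⊔ ℓ)
  Invertible x = ∃ λ y → x * y ≈ 1#

  int-resp : ∀ {x y} → x ≈ y → IsInt y → IsInt x
  int-resp x≈y (i , eq) = i , ≈-trans x≈y eq

  int-0 : IsInt 0#
  int-0 = + 0 , ≈-refl

  int-1 : IsInt 1#
  int-1 = + 1 , coefficient≈fromℤ (+ 1)

  int-ℕ : ∀ n → IsInt (fromℕ K n)
  int-ℕ n = + n , ≈-refl

  int-+ : ∀ {x y} → IsInt x → IsInt y → IsInt (x + y)
  int-+ (i , p) (j , q) = i ℤ.+ j , ≈-trans (+-cong p q) (≈-sym (fromℤ-+ i j))

  int-* : ∀ {x y} → IsInt x → IsInt y → IsInt (x * y)
  int-* (i , p) (j , q) = i ℤ.* j , ≈-trans (*-cong p q) (≈-sym (fromℤ-* i j))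

  int-neg : ∀ {x} → IsInt x → IsInt (- x)
  int-neg (i , p) = ℤ.- i , ≈-trans (-‿cong p) (≈-sym (fromℤ-neg i))

  int-∑< : ∀ n {u} → (∀ i → IsInt (u i)) → IsInt (∑< n u)
  int-∑< zero    int-u = int-0
  int-∑< (suc n) int-u = int-+ (int-u 0) (int-∑< n (int-u ∘ suc))

  *-cancelˡ-invertible : ∀ {x} → Invertible x → ∀ {a b} → x * a ≈ x * b → a ≈ b
  *-cancelˡ-invertible {x} (y , xy≈1) {a} {b} xa≈xb = begin
    a            ≈⟨ expand a ⟩
    y * (x * a)  ≈⟨ *-congˡ xa≈xb ⟩
    y * (x * b)  ≈⟨ expand b ⟨
    b            ∎
    where
    expand : ∀ a → a ≈ y * (x * a)
    expand a = begin
      a            ≈⟨ *-identityˡ a ⟨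
      1# * a       ≈⟨ *-congʳ xy≈1 ⟨
      x * y * a    ≈⟨ *-congʳ (*-comm x y) ⟩
      y * x * a    ≈⟨ *-assoc y x a ⟩
      y * (x * a)  ∎

  pow-cong : ∀ {x y} k → x ≈ y → pow K x k ≈ pow K y k
  pow-cong zero    x≈y = ≈-refl
  pow-cong (suc k) x≈y = *-cong x≈y (pow-cong k x≈y)

  pow-+ : ∀ x m n → pow K x (m ℕ.+ n) ≈ pow K x m * pow K x n
  pow-+ x zero    n = ≈-sym (*-identityˡ _)
  pow-+ x (suc m) n = ≈-trans (*-congˡ (pow-+ x m n)) (≈-sym (*-assoc _ _ _))

  pow-1# : ∀ k → pow K 1# k ≈ 1#
  pow-1# zero    = ≈-refl
  pow-1# (suc k) = ≈-trans (*-identityˡ _) (pow-1# k)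

  pow-* : ∀ x m n → pow K x (m ℕ.* n) ≈ pow K (pow K x n) m
  pow-* x zero    n = ≈-refl
  pow-* x (suc m) n = ≈-trans (pow-+ x n (m ℕ.* n)) (*-congˡ (pow-* x m n))

  pow-distrib-* : ∀ x y k → pow K (x * y) k ≈ pow K x k * pow K y k
  pow-distrib-* x y zero    = ≈-sym (*-identityˡ _)
  pow-distrib-* x y (suc k) = ≈-trans (*-congˡ (pow-distrib-* x y k)) (interchange x y _ _)
    where open BigOperator *-commutativeMonoid using (interchange)

  fromℤ-^ : ∀ i k → fromℤ K (i ℤ.^ k) ≈ pow K (fromℤ K i) k
  fromℤ-^ i zero    = ≈-sym (coefficient≈fromℤ (+ 1))
  fromℤ-^ i (suc k) = ≈-trans (fromℤ-* i (i ℤ.^ k)) (*-congˡ (fromℤ-^ i k))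

  module _ (charZero : CharZero K) where

    fromℤ-≈0 : ∀ i → fromℤ K i ≈ 0# → i ≡ + 0
    fromℤ-≈0 (+ zero)  _  = refl
    fromℤ-≈0 (+ suc n) eq = ⊥-elim (charZero n eq)
    fromℤ-≈0 -[1+ n ]  eq = ⊥-elim (charZero n (≈-trans (fromℤ-neg -[1+ n ]) (≈-trans (-‿cong eq) -0#≈0#)))

    fromℤ-injective : ∀ i j → fromℤ K i ≈ fromℤ K j → i ≡ j
    fromℤ-injective i j eq = ℤₚ.i-j≡0⇒i≡j i j (fromℤ-≈0 (i ℤ.- j) (begin
      fromℤ K (i ℤ.- j)                  ≈⟨ fromℤ-+ i (ℤ.- j) ⟩
      fromℤ K i + fromℤ K (ℤ.- j)        ≈⟨ +-cong eq (fromℤ-neg j) ⟩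
      fromℤ K j - fromℤ K j              ≈⟨ -‿inverseʳ _ ⟩
      0#                                 ∎))

    -- With N R = z and N R ^ (N + 1) = w one gets N ^ N w = z ^ (N + 1), hence N ∣ z.
    bounded-denominator⇒int : IsField K → ∀ N .{{_ : NonZero N}} (R : Carrier) →
                              (∀ t → IsInt (fromℕ K N * pow K R t)) → IsInt R
    bounded-denominator⇒int (_ , inverse) N@(suc N-1) R int-NR with int-NR 1 | int-NR (suc N)
    ... | z , NR≈z | w , NRᴺ⁺¹≈w = ℤ∣.quotient N∣z , *-cancelˡ-invertible (inverse (fromℕ K N) (charZero N-1)) (begin
      fromℕ K N * R                              ≈⟨ NR≈z′ ⟩
      fromℤ K z                                  ≡⟨ cong (fromℤ K) (ℤ∣._∣_.equality N∣z) ⟩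
      fromℤ K (ℤ∣.quotient N∣z ℤ.* + N)          ≈⟨ fromℤ-* (ℤ∣.quotient N∣z) (+ N) ⟩
      fromℤ K (ℤ∣.quotient N∣z) * fromℕ K N      ≈⟨ *-comm _ _ ⟩
      fromℕ K N * fromℤ K (ℤ∣.quotient N∣z)      ∎)
      where
      NR≈z′ : fromℕ K N * R ≈ fromℤ K z
      NR≈z′ = ≈-trans (*-congˡ (≈-sym (*-identityʳ R))) NR≈z

      NᴺW≡zᴺ⁺¹ : w ℤ.* (+ N) ℤ.^ N ≡ z ℤ.^ suc N
      NᴺW≡zᴺ⁺¹ = fromℤ-injective _ _ (begin
        fromℤ K (w ℤ.* (+ N) ℤ.^ N)                        ≈⟨ fromℤ-* w ((+ N) ℤ.^ N) ⟩
        fromℤ K w * fromℤ K ((+ N) ℤ.^ N)                  ≈⟨ *-cong (≈-sym NRᴺ⁺¹≈w) (fromℤ-^ (+ N) N) ⟩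
        fromℕ K N * pow K R (suc N) * pow K (fromℕ K N) N  ≈⟨ solve 3 (λ a b c → a :* b :* c := a :* c :* b) ≈-refl _ _ _ ⟩
        pow K (fromℕ K N) (suc N) * pow K R (suc N)        ≈⟨ pow-distrib-* (fromℕ K N) R (suc N) ⟨
        pow K (fromℕ K N * R) (suc N)                      ≈⟨ pow-cong (suc N) NR≈z′ ⟩
        pow K (fromℤ K z) (suc N)                          ≈⟨ fromℤ-^ z (suc N) ⟨
        fromℤ K (z ℤ.^ suc N)                              ∎)

      N∣z : (+ N) ℤ∣.∣ z
      N∣z = ℤ∣.∣ᵤ⇒∣ (^-∣-^suc⇒∣ N ℤ.∣ z ∣ (divides ℤ.∣ w ∣
        (≡.trans (≡.sym (abs-^ z (suc N))) (≡.trans (cong ℤ.∣_∣ (≡.sym NᴺW≡zᴺ⁺¹))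
          (≡.trans (ℤₚ.abs-* w ((+ N) ℤ.^ N)) (cong (ℤ.∣ w ∣ ℕ.*_) (abs-^ (+ N) N)))))))

-- Power sums and Newton's identities

module _ {a} {A : Set a} where

  -- Selection goes by position rather than by value: this requires no decidable equality, and
  -- repeated roots count with multiplicity.
  selections : List A → List (A × List A)
  selections []       = []
  selections (x ∷ xs) = (x , xs) ∷ map (λ (y , ys) → y , x ∷ ys) (selections xs)

  selections-↭ : ∀ xs {x ys} → (x , ys) ∈ selections xs → x ∷ ys ↭ xs
  selections-↭ (x ∷ xs) (here refl) = Perm.refl
  selections-↭ (x ∷ xs) (there p) with ∈-map⁻ _ p
  ... | (y , ys) , q , refl = ↭-trans (swap y x Perm.refl) (prep x (selections-↭ xs q))

module PowerSums {c ℓ : Level} (K : CommutativeRing c ℓ) where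
  open RingLemmas K
  open Integrality K
  open import Relation.Binary.Reasoning.Setoid setoid
  open BigOperator +-commutativeMonoid public using ()
    renaming (⨁ to ∑; ⨁-cong-∈ to ∑-cong-∈; ⨁-cong to ∑-cong; ⨁-ε to ∑-0; ⨁-∙ to ∑-+; ⨁-++ to ∑-++; ⨁-↭ to ∑-↭; ⨁-map to ∑-map; ⨁-swap to ∑-swap)

  ∑-*ˡ : ∀ {a} {A : Set a} (xs : List A) k f → ∑ xs (λ x → k * f x) ≈ k * ∑ xs f
  ∑-*ˡ []       k f = ≈-sym (zeroʳ k)
  ∑-*ˡ (x ∷ xs) k f = ≈-trans (+-congˡ (∑-*ˡ xs k f)) (≈-sym (distribˡ _ _ _))

  ∑-const : ∀ {a} {A : Set a} (xs : List A) k → ∑ xs (λ _ → k) ≈ fromℕ K (length xs) * k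
  ∑-const []       k = ≈-sym (zeroˡ k)
  ∑-const (x ∷ xs) k = ≈-trans (+-cong (≈-sym (*-identityˡ k)) (∑-const xs k)) (≈-sym (distribʳ _ _ _))

  ∑-selections : ∀ {a} {A : Set a} (xs : List A) (f : A → Carrier) → ∑ (selections xs) (f ∘ proj₁) ≡ ∑ xs f
  ∑-selections []       f = refl
  ∑-selections (x ∷ xs) f = cong (_+_ (f x))
    (≡.trans (∑-map (λ (y , ys) → y , x ∷ ys) (selections xs) (f ∘ proj₁)) (∑-selections xs f))

  coeff : ℕ → List Carrier → Carrier
  coeff i       []      = 0#
  coeff zero    (a ∷ p) = a
  coeff (suc i) (a ∷ p) = coeff i p

  coeff-addP : ∀ i p q → coeff i (addP K p q) ≈ coeff i p + coeff i q
  coeff-addP i       []      q       = ≈-sym (+-identityˡ _)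
  coeff-addP zero    (a ∷ p) []      = ≈-sym (+-identityʳ _)
  coeff-addP (suc i) (a ∷ p) []      = ≈-sym (+-identityʳ _)
  coeff-addP zero    (a ∷ p) (b ∷ q) = ≈-refl
  coeff-addP (suc i) (a ∷ p) (b ∷ q) = coeff-addP i p q

  coeff-scale : ∀ i k p → coeff i (map (λ u → k * u) p) ≈ k * coeff i p
  coeff-scale i       k []      = ≈-sym (zeroʳ k)
  coeff-scale zero    k (a ∷ p) = ≈-refl
  coeff-scale (suc i) k (a ∷ p) = coeff-scale i k p

  -- The coefficient of Xⁱ in ∏ (X - a), with its sign and counted from the constant term. It is the
  -- elementary symmetric function of degree d - i up to sign, in the normalisation that `AreRoots`
  -- compares.
  e : ℕ → List Carrier → Carrier
  e i as = coeff i (rootPoly K as)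

  -- e⁻ i is e (i - 1), with the convention e (-1) = 0.
  e⁻ : ℕ → List Carrier → Carrier
  e⁻ i as = coeff i (0# ∷ rootPoly K as)

  e-∷ : ∀ i a as → e i (a ∷ as) ≈ e⁻ i as - a * e i as
  e-∷ i a as = ≈-trans (coeff-addP i (0# ∷ rootPoly K as) (map (λ u → - a * u) (rootPoly K as)))
    (+-congˡ (≈-trans (coeff-scale i (- a) (rootPoly K as)) (≈-sym (-‿distribˡ-* a _))))

  e-∷-cong : ∀ a as bs → (∀ i → e i as ≈ e i bs) → ∀ i → e i (a ∷ as) ≈ e i (a ∷ bs)
  e-∷-cong a as bs as≈bs i = begin
    e i (a ∷ as)           ≈⟨ e-∷ i a as ⟩
    e⁻ i as - a * e i as   ≈⟨ +-cong (e⁻-cong i) (-‿cong (*-congˡ (as≈bs i))) ⟩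
    e⁻ i bs - a * e i bs   ≈⟨ e-∷ i a bs ⟨
    e i (a ∷ bs)           ∎
    where
    e⁻-cong : ∀ i → e⁻ i as ≈ e⁻ i bs
    e⁻-cong zero    = ≈-refl
    e⁻-cong (suc i) = as≈bs i

  e-swap : ∀ a b as i → e i (a ∷ b ∷ as) ≈ e i (b ∷ a ∷ as)
  e-swap a b as i = ≈-trans (expand a b i) (≈-trans (symmetric i) (≈-sym (expand b a i)))
    where
    expand : ∀ a b i → e i (a ∷ b ∷ as) ≈ e⁻ i (b ∷ as) - a * (e⁻ i as - b * e i as)
    expand a b i = ≈-trans (e-∷ i a (b ∷ as)) (+-congˡ (-‿cong (*-congˡ (e-∷ i b as))))

    symmetric : ∀ i → e⁻ i (b ∷ as) - a * (e⁻ i as - b * e i as) ≈ e⁻ i (a ∷ as) - b * (e⁻ i as - a * e i as)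
    symmetric zero    = solve 3 (λ a b x → con (+ 0) :- a :* (con (+ 0) :- b :* x) := con (+ 0) :- b :* (con (+ 0) :- a :* x))
                          ≈-refl a b (e 0 as)
    symmetric (suc i) = ≈-trans (+-congʳ (e-∷ i b as)) (≈-trans
      (solve 5 (λ a b x y z → (x :- b :* y) :- a :* (y :- b :* z) := (x :- a :* y) :- b :* (y :- a :* z))
        ≈-refl a b (e⁻ i as) (e i as) (e (suc i) as))
      (+-congʳ (≈-sym (e-∷ i a as))))

  e-↭ : ∀ {as bs} → as ↭ bs → ∀ i → e i as ≈ e i bs
  e-↭ Perm.refl        i = ≈-refl
  e-↭ (prep {as} {bs} a p) i = e-∷-cong a as bs (e-↭ p) i
  e-↭ (swap {as} {bs} a b p) i = ≈-trans (e-swap a b as i) (e-∷-cong b (a ∷ as) (a ∷ bs) (e-∷-cong a as bs (e-↭ p)) i)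
  e-↭ (Perm.trans p q) i = ≈-trans (e-↭ p i) (e-↭ q i)

  -- The derivative of ∏ (X - x) is the sum of the products omitting one factor.
  ∑-selections-e : ∀ i as → ∑ (selections as) (λ (_ , r) → e i r) ≈ fromℕ K (suc i) * e (suc i) as
  ∑-selections-e i []       = ≈-sym (zeroʳ _)
  ∑-selections-e i (a ∷ as) = begin
    e i as + ∑ (map (λ (y , ys) → y , a ∷ ys) (selections as)) (λ (_ , r) → e i r)
      ≡⟨ cong (_+_ (e i as)) (∑-map _ (selections as) _) ⟩
    e i as + ∑ (selections as) (λ (_ , r) → e i (a ∷ r))
      ≈⟨ +-congˡ (∑-cong (selections as) (λ (_ , r) → ≈-trans (e-∷ i a r) (+-congˡ (-‿distribˡ-* a (e i r))))) ⟩
    e i as + ∑ (selections as) (λ (_ , r) → e⁻ i r + - a * e i r)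
      ≈⟨ +-congˡ (∑-+ (selections as) _ _) ⟩
    e i as + (∑ (selections as) (λ (_ , r) → e⁻ i r) + ∑ (selections as) (λ (_ , r) → - a * e i r))
      ≈⟨ +-congˡ (+-cong (∑-e⁻ i) (≈-trans (∑-*ˡ (selections as) (- a) _) (*-congˡ (∑-selections-e i as)))) ⟩
    e i as + (fromℕ K i * e i as + - a * ((1# + fromℕ K i) * e (suc i) as))
      ≈⟨ solve 4 (λ n a x y → x :+ (n :* x :+ :- a :* ((con (+ 1) :+ n) :* y)) := (con (+ 1) :+ n) :* (x :- a :* y))
           ≈-refl (fromℕ K i) a (e i as) (e (suc i) as) ⟩
    fromℕ K (suc i) * (e i as - a * e (suc i) as)
      ≈⟨ *-congˡ (e-∷ (suc i) a as) ⟨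
    fromℕ K (suc i) * e (suc i) (a ∷ as) ∎
    where
    ∑-e⁻ : ∀ i → ∑ (selections as) (λ (_ , r) → e⁻ i r) ≈ fromℕ K i * e i as
    ∑-e⁻ zero    = ≈-trans (∑-0 (selections as)) (≈-sym (zeroˡ _))
    ∑-e⁻ (suc i) = ∑-selections-e i as

  e-above-degree : ∀ as i → length as < i → e i as ≈ 0#
  e-above-degree []       (suc i) _           = ≈-refl
  e-above-degree (a ∷ as) (suc i) (s≤s |as|<i) = begin
    e (suc i) (a ∷ as)         ≈⟨ e-∷ (suc i) a as ⟩
    e i as - a * e (suc i) as  ≈⟨ +-cong (e-above-degree as i |as|<i) (-‿cong (*-congˡ (e-above-degree as (suc i) (ℕₚ.m≤n⇒m≤1+n |as|<i)))) ⟩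
    0# - a * 0#                ≈⟨ solve 1 (λ a → con (+ 0) :- a :* con (+ 0) := con (+ 0)) ≈-refl a ⟩
    0#                         ∎

  e-monic : ∀ as → e (length as) as ≈ 1#
  e-monic []       = ≈-refl
  e-monic (a ∷ as) = begin
    e (suc (length as)) (a ∷ as)                         ≈⟨ e-∷ (suc (length as)) a as ⟩
    e (length as) as - a * e (suc (length as)) as        ≈⟨ +-cong (e-monic as) (-‿cong (*-congˡ (e-above-degree as _ ℕₚ.≤-refl))) ⟩
    1# - a * 0#                                          ≈⟨ solve 1 (λ a → con (+ 1) :- a :* con (+ 0) := con (+ 1)) ≈-refl a ⟩
    1#                                                   ∎

  psum : ℕ → List Carrier → Carrier
  psum j as = ∑ as (λ x → pow K x j)

  -- Newton's identities, in the form of a recursion for the mixed sums Σₓ xʲ e i (as ∖ x),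
  -- which contain the power sums because e (d - 1) (as ∖ x) = 1.
  module _ (as : List Carrier) (int-e : ∀ i → IsInt (e i as)) where

    mixedSum : ℕ → ℕ → Carrier
    mixedSum i j = ∑ (selections as) (λ (x , r) → pow K x j * e i r)

    psum≈mixedSum : ∀ d j → length as ≡ suc d → psum j as ≈ mixedSum d j
    psum≈mixedSum d j |as|≡1+d = ≈-trans (reflexive (≡.sym (∑-selections as (λ x → pow K x j))))
      (∑-cong-∈ (selections as) (λ {(x , r)} p → ≈-sym (≈-trans
        (*-congˡ (≈-trans (reflexive (cong (λ k → e k r) (≡.sym (remainder-length p)))) (e-monic r)))
        (*-identityʳ _))))
      where
      remainder-length : ∀ {x r} → (x , r) ∈ selections as → length r ≡ d
      remainder-length p = ℕₚ.suc-injective (≡.trans (Permₚ.↭-length (selections-↭ as p)) |as|≡1+d)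

    int-psum-from-mixedSum : ∀ j → (∀ i → IsInt (mixedSum i j)) → IsInt (psum j as)
    -- The relevant index is d - 1, which does not exist for the empty list; all power sums are 0#
    -- there.
    int-psum-from-mixedSum j int-s with length as in |as|≡
    ... | suc d = int-resp (psum≈mixedSum d j |as|≡) (int-s d)
    ... | zero  = int-resp (reflexive (cong (psum j) (empty as |as|≡))) int-0
      where
      empty : ∀ (xs : List Carrier) → length xs ≡ 0 → xs ≡ []
      empty [] _ = refl

    -- Comparing coefficients in ∏ (X - a) = (X - x) ∏ (X - b), with b running over the remaining
    -- entries r, gives x * e i r = e⁻ i r - e i as. This trades one power of x for a lower index i
    -- and a term free of r.
    mixedSum-step : ∀ i j → mixedSum i (suc j) ≈ ∑ (selections as) (λ (x , r) → pow K x j * e⁻ i r) - e i as * psum j as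
    mixedSum-step i j = begin
      mixedSum i (suc j)
        ≈⟨ ∑-cong-∈ (selections as) (λ {(x , r)} p → step x r (selections-↭ as p)) ⟩
      ∑ (selections as) (λ (x , r) → pow K x j * e⁻ i r + - e i as * pow K x j)
        ≈⟨ ∑-+ (selections as) _ _ ⟩
      ∑ (selections as) (λ (x , r) → pow K x j * e⁻ i r) + ∑ (selections as) (λ (x , r) → - e i as * pow K x j)
        ≈⟨ +-congˡ (∑-*ˡ (selections as) (- e i as) (λ (x , _) → pow K x j)) ⟩
      ∑ (selections as) (λ (x , r) → pow K x j * e⁻ i r) + - e i as * ∑ (selections as) (λ (x , _) → pow K x j)
        ≈⟨ +-congˡ (≈-trans (*-congˡ (reflexive (∑-selections as (λ x → pow K x j)))) (≈-sym (-‿distribˡ-* _ _))) ⟩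
      ∑ (selections as) (λ (x , r) → pow K x j * e⁻ i r) - e i as * psum j as ∎
      where
      step : ∀ x r → x ∷ r ↭ as → pow K x (suc j) * e i r ≈ pow K x j * e⁻ i r + - e i as * pow K x j
      step x r p = begin
        x * pow K x j * e i r
          ≈⟨ solve 4 (λ x y u v → x :* y :* u := y :* v :+ :- (v :- x :* u) :* y) ≈-refl x (pow K x j) (e i r) (e⁻ i r) ⟩
        pow K x j * e⁻ i r + - (e⁻ i r - x * e i r) * pow K x j
          ≈⟨ +-congˡ (*-congʳ (-‿cong (≈-trans (≈-sym (e-∷ i x r)) (e-↭ p i)))) ⟩
        pow K x j * e⁻ i r + - e i as * pow K x j ∎

    -- Induction on j for all i at once: the step from j uses the index i - 1 and also `psum j as`,
    -- which is the mixed sum at the index d - 1. The case j = 0 is the coefficient formula for the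
    -- derivative.
    int-mixedSum : ∀ j i → IsInt (mixedSum i j)
    int-mixedSum zero    i = int-resp (≈-trans (∑-cong (selections as) (λ _ → *-identityˡ _)) (∑-selections-e i as))
                               (int-* (int-ℕ (suc i)) (int-e (suc i)))
    int-mixedSum (suc j) i = int-resp (mixedSum-step i j)
      (int-+ (int-first i) (int-neg (int-* (int-e i) (int-psum-from-mixedSum j (int-mixedSum j)))))
      where
      int-first : ∀ i → IsInt (∑ (selections as) (λ (x , r) → pow K x j * e⁻ i r))
      int-first zero    = int-resp (≈-trans (∑-cong (selections as) (λ _ → zeroʳ _)) (∑-0 (selections as))) int-0
      int-first (suc i) = int-mixedSum j i

    int-psum : ∀ j → IsInt (psum j as)
    int-psum j = int-psum-from-mixedSum j (int-mixedSum j)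

-- Elimination of variables by summing over permutations

infixl 6 _⊕_
infixl 7 _⊗_

-- Integer polynomials in the variables of an environment and in the power sums of a second list.
data Expr : Set where
  con  : ℤ → Expr
  var  : ℕ → Expr
  powerSum : ℕ → Expr
  _⊕_  : Expr → Expr → Expr
  _⊗_  : Expr → Expr → Expr

-- The summand (j , a) stands for xʲ a, where x is the variable being eliminated.
mulTerms : List (ℕ × Expr) → List (ℕ × Expr) → List (ℕ × Expr)
mulTerms []            ts = []
mulTerms ((i , a) ∷ ss) ts = map (λ (j , b) → i ℕ.+ j , a ⊗ b) ts ++ mulTerms ss ts

-- The eliminated variable x is `var 0`, and the others move down by one. A power sum over the
-- entries left after x is chosen becomes the one over all entries minus xⁱ, which accounts for the
-- coefficient -1.
collect : Expr → List (ℕ × Expr)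
collect (con i)       = (0 , con i) ∷ []
collect (var zero)    = (1 , con (+ 1)) ∷ []
collect (var (suc i)) = (0 , var i) ∷ []
collect (powerSum i)      = (0 , powerSum i) ∷ (i , con (ℤ.- + 1)) ∷ []
collect (f ⊕ g)       = collect f ++ collect g
collect (f ⊗ g)       = mulTerms (collect f) (collect g)

-- Summing xʲ a over x replaces xʲ by the j-th power sum, since a does not involve x. For j = 0 this
-- is the number of choices for x.
eliminate : Expr → Expr
eliminate f = foldr (λ (j , a) g → powerSum j ⊗ a ⊕ g) (con (+ 0)) (collect f)

eliminateMany : ℕ → Expr → Expr
eliminateMany zero    f = f
eliminateMany (suc k) f = eliminate (eliminateMany k f)

-- `powerSum` refers to one list only. Once the ζ's are eliminated, their power sums are frozen to
-- integers, which frees the constructor for the power sums of the α's.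
substPsums : (ℕ → ℤ) → Expr → Expr
substPsums z (con i)  = con i
substPsums z (var i)  = var i
substPsums z (powerSum j) = con (z j)
substPsums z (f ⊕ g)  = substPsums z f ⊕ substPsums z g
substPsums z (f ⊗ g)  = substPsums z f ⊗ substPsums z g

module Symmetrisation {c ℓ : Level} (K : CommutativeRing c ℓ) where
  open RingLemmas K
  open Integrality K
  open PowerSums K
  open import Relation.Binary.Reasoning.Setoid setoid

  -- rest holds the values not yet assigned to variables; var i reads 0# beyond the end of env.
  ⟦_⟧ : Expr → List Carrier → List Carrier → Carrier
  ⟦ con i ⟧  rest env = fromℤ K i
  ⟦ var i ⟧  rest env = coeff i env
  ⟦ powerSum j ⟧ rest env = psum j rest
  ⟦ f ⊕ g ⟧  rest env = ⟦ f ⟧ rest env + ⟦ g ⟧ rest env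
  ⟦ f ⊗ g ⟧  rest env = ⟦ f ⟧ rest env * ⟦ g ⟧ rest env

  module _ (x : Carrier) (rest env : List Carrier) where

    term : ℕ × Expr → Carrier
    term (j , a) = pow K x j * ⟦ a ⟧ rest env

    ∑-mulTerms : ∀ ss ts → ∑ (mulTerms ss ts) term ≈ ∑ ss term * ∑ ts term
    ∑-mulTerms []             ts = ≈-sym (zeroˡ _)
    ∑-mulTerms ((i , a) ∷ ss) ts = begin
      ∑ (map (λ (j , b) → i ℕ.+ j , a ⊗ b) ts ++ mulTerms ss ts) term
        ≈⟨ ∑-++ (map _ ts) (mulTerms ss ts) term ⟩
      ∑ (map (λ (j , b) → i ℕ.+ j , a ⊗ b) ts) term + ∑ (mulTerms ss ts) term
        ≈⟨ +-cong (≈-trans (reflexive (∑-map _ ts term)) (≈-trans (∑-cong ts mulTerm) (∑-*ˡ ts (term (i , a)) term)))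
                  (∑-mulTerms ss ts) ⟩
      term (i , a) * ∑ ts term + ∑ ss term * ∑ ts term
        ≈⟨ distribʳ _ _ _ ⟨
      (term (i , a) + ∑ ss term) * ∑ ts term ∎
      where
      mulTerm : ∀ t → term (i ℕ.+ proj₁ t , a ⊗ proj₂ t) ≈ term (i , a) * term t
      mulTerm (j , b) = ≈-trans (*-congʳ (pow-+ x i j))
        (solve 4 (λ p q u v → (p :* q) :* (u :* v) := (p :* u) :* (q :* v)) ≈-refl (pow K x i) (pow K x j) _ _)

    -- The coefficients on the left are evaluated over the whole of `rest`, so they are the same for
    -- every selected x; only this allows the sum over x to be exchanged with the sum over the
    -- collected terms.
    ∑-collect : ∀ r → x ∷ r ↭ rest → ∀ f → ∑ (collect f) term ≈ ⟦ f ⟧ r (x ∷ env)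
    ∑-collect r p (con i)       = ≈-trans (+-identityʳ _) (*-identityˡ _)
    ∑-collect r p (var zero)    = ≈-trans (+-identityʳ _) (≈-trans (*-cong (*-identityʳ x) (+-identityʳ 1#)) (*-identityʳ x))
    ∑-collect r p (var (suc i)) = ≈-trans (+-identityʳ _) (*-identityˡ _)
    ∑-collect r p (powerSum i)      = begin
      1# * psum i rest + (pow K x i * - (1# + 0#) + 0#)
        ≈⟨ +-congʳ (*-congˡ (≈-sym (∑-↭ (λ y → pow K y i) p))) ⟩
      1# * (pow K x i + psum i r) + (pow K x i * - (1# + 0#) + 0#)
        ≈⟨ solve 2 (λ y z → con (+ 1) :* (y :+ z) :+ (y :* :- (con (+ 1) :+ con (+ 0)) :+ con (+ 0)) := z)
             ≈-refl (pow K x i) (psum i r) ⟩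
      psum i r ∎
    ∑-collect r p (f ⊕ g)       = ≈-trans (∑-++ (collect f) (collect g) term) (+-cong (∑-collect r p f) (∑-collect r p g))
    ∑-collect r p (f ⊗ g)       = ≈-trans (∑-mulTerms (collect f) (collect g)) (*-cong (∑-collect r p f) (∑-collect r p g))

  ⟦eliminate⟧ : ∀ f rest env → ⟦ eliminate f ⟧ rest env ≈ ∑ (selections rest) (λ (x , r) → ⟦ f ⟧ r (x ∷ env))
  ⟦eliminate⟧ f rest env = begin
    ⟦ eliminate f ⟧ rest env
      ≈⟨ unfold (collect f) ⟩
    ∑ (collect f) (λ (j , a) → psum j rest * ⟦ a ⟧ rest env)
      ≈⟨ ∑-cong (collect f) (λ (j , a) → spread j (⟦ a ⟧ rest env)) ⟩
    ∑ (collect f) (λ t → ∑ (selections rest) (λ (x , _) → term x rest env t))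
      ≈⟨ ∑-swap (collect f) (selections rest) _ ⟩
    ∑ (selections rest) (λ (x , _) → ∑ (collect f) (term x rest env))
      ≈⟨ ∑-cong-∈ (selections rest) (λ {(x , r)} p → ∑-collect x rest env r (selections-↭ rest p) f) ⟩
    ∑ (selections rest) (λ (x , r) → ⟦ f ⟧ r (x ∷ env)) ∎
    where
    unfold : ∀ ts → ⟦ foldr (λ (j , a) g → powerSum j ⊗ a ⊕ g) (con (+ 0)) ts ⟧ rest env ≈
                    ∑ ts (λ (j , a) → psum j rest * ⟦ a ⟧ rest env)
    unfold []       = ≈-refl
    unfold (t ∷ ts) = +-congˡ (unfold ts)

    spread : ∀ j y → psum j rest * y ≈ ∑ (selections rest) (λ (x , _) → pow K x j * y)
    spread j y = begin
      psum j rest * y                                      ≈⟨ *-comm _ _ ⟩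
      y * psum j rest                                      ≡⟨ cong (y *_) (∑-selections rest (λ x → pow K x j)) ⟨
      y * ∑ (selections rest) (λ (x , _) → pow K x j)          ≈⟨ ∑-*ˡ (selections rest) y _ ⟨
      ∑ (selections rest) (λ (x , _) → y * pow K x j)          ≈⟨ ∑-cong (selections rest) (λ _ → *-comm _ _) ⟩
      ∑ (selections rest) (λ (x , _) → pow K x j * y)          ∎

  -- A sum over all permutations of rest, in which every summand takes the common value v.
  ⟦eliminateMany⟧ : ∀ f v k rest env → length rest ≡ k →
                    (∀ xs → xs ↭ rest → ⟦ f ⟧ [] (xs ++ env) ≈ v) →
                    ⟦ eliminateMany k f ⟧ rest env ≈ fromℕ K (k !) * v
  ⟦eliminateMany⟧ f v zero    []   env _     f≈v = ≈-trans (f≈v [] Perm.refl)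
    (≈-sym (≈-trans (*-congʳ (+-identityʳ 1#)) (*-identityˡ v)))
  ⟦eliminateMany⟧ f v (suc k) rest env |rest|≡ f≈v = begin
    ⟦ eliminate (eliminateMany k f) ⟧ rest env
      ≈⟨ ⟦eliminate⟧ (eliminateMany k f) rest env ⟩
    ∑ (selections rest) (λ (x , r) → ⟦ eliminateMany k f ⟧ r (x ∷ env))
      ≈⟨ ∑-cong-∈ (selections rest) (λ {(x , r)} p → ⟦eliminateMany⟧ f v k r (x ∷ env)
           (ℕₚ.suc-injective (≡.trans (Permₚ.↭-length (selections-↭ rest p)) |rest|≡))
           -- Values chosen earlier lie deeper in the environment, so the selected x is the last
           -- entry of the resulting permutation.
           (λ xs xs↭r → ≈-trans (reflexive (cong (⟦ f ⟧ []) (≡.sym (Listₚ.++-assoc xs (x ∷ []) env))))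
             (f≈v (xs ++ x ∷ []) (↭-trans (↭-sym (Permₚ.∷↭∷ʳ x xs)) (↭-trans (prep x xs↭r) (selections-↭ rest p)))))) ⟩
    ∑ (selections rest) (λ _ → fromℕ K (k !) * v)
      ≈⟨ ∑-const (selections rest) _ ⟩
    fromℕ K (length (selections rest)) * (fromℕ K (k !) * v)
      ≡⟨ cong (λ m → fromℕ K m * (fromℕ K (k !) * v)) (≡.trans (length-selections rest) |rest|≡) ⟩
    fromℕ K (suc k) * (fromℕ K (k !) * v)
      ≈⟨ *-assoc _ _ _ ⟨
    fromℕ K (suc k) * fromℕ K (k !) * v
      ≈⟨ *-congʳ (fromℕ-* (suc k) (k !)) ⟨
    fromℕ K (suc k !) * v ∎
    where
    length-selections : ∀ (xs : List Carrier) → length (selections xs) ≡ length xs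
    length-selections []       = refl
    length-selections (x ∷ xs) = cong suc (≡.trans (Listₚ.length-map _ (selections xs)) (length-selections xs))

  module _ (as : List Carrier) (int-psums : ∀ j → IsInt (psum j as)) where

    ⟦substPsums⟧ : ∀ f rest env → ⟦ substPsums (proj₁ ∘ int-psums) f ⟧ rest env ≈ ⟦ f ⟧ as env
    ⟦substPsums⟧ (con i)  rest env = ≈-refl
    ⟦substPsums⟧ (var i)  rest env = ≈-refl
    ⟦substPsums⟧ (powerSum j) rest env = ≈-sym (proj₂ (int-psums j))
    ⟦substPsums⟧ (f ⊕ g)  rest env = +-cong (⟦substPsums⟧ f rest env) (⟦substPsums⟧ g rest env)
    ⟦substPsums⟧ (f ⊗ g)  rest env = *-cong (⟦substPsums⟧ f rest env) (⟦substPsums⟧ g rest env)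

    int-⟦⟧ : ∀ f → IsInt (⟦ f ⟧ as [])
    int-⟦⟧ (con i)  = i , ≈-refl
    int-⟦⟧ (var i)  = int-0
    int-⟦⟧ (powerSum j) = int-psums j
    int-⟦⟧ (f ⊕ g)  = int-+ (int-⟦⟧ f) (int-⟦⟧ g)
    int-⟦⟧ (f ⊗ g)  = int-* (int-⟦⟧ f) (int-⟦⟧ g)

-- Primitive roots of unity: Ramanujan sums and the symmetry of the cyclotomic form

module RootsOfUnity {c ℓ : Level} (K : CommutativeRing c ℓ) (isField : IsField K) where
  open RingLemmas K
  open Integrality K
  open PowerSums K
  open import Relation.Binary.Reasoning.Setoid setoid
  open BigOperator +-commutativeMonoid using ()
    renaming (⨁< to ∑<; ⨁<-cong to ∑<-cong; ⨁<-last to ∑<-last; ⨁-filter to ∑-filter; ⨁-applyUpTo to ∑-applyUpTo; guarded to guarded₀)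
  open BigOperator *-commutativeMonoid
    renaming (⨁ to ∏; ⨁-cong-∈ to ∏-cong-∈; ⨁-∙ to ∏-*; ⨁< to ∏<; ⨁<-cong to ∏<-cong; ⨁<-last to ∏<-last;
              ⨁<-reverse to ∏<-reverse; ⨁-filter to ∏-filter; ⨁-applyUpTo to ∏-applyUpTo; guarded to guarded₁)

  invertible-difference : ∀ {x y} → ¬ (x ≈ y) → Invertible (x - y)
  invertible-difference {x} {y} x≉y = proj₂ isField (x - y) (λ x-y≈0 → x≉y (begin
    x              ≈⟨ solve 2 (λ x y → x := (x :- y) :+ y) ≈-refl x y ⟩
    (x - y) + y    ≈⟨ +-congʳ x-y≈0 ⟩
    0# + y         ≈⟨ +-identityˡ y ⟩
    y              ∎))

  invertible-∏ : ∀ {a} {A : Set a} (xs : List A) {f} → (∀ {x} → x ∈ xs → Invertible (f x)) → Invertible (∏ xs f)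
  invertible-∏ []       inv-f = 1# , *-identityˡ 1#
  invertible-∏ (x ∷ xs) inv-f with inv-f (here refl) | invertible-∏ xs (inv-f ∘ there)
  ... | u , fx*u≈1 | v , ∏*v≈1 = u * v , ≈-trans (interchange _ _ _ _) (≈-trans (*-cong fx*u≈1 ∏*v≈1) (*-identityˡ 1#))

  upTo⁺ : ℕ → List ℕ
  upTo⁺ n = map suc (upTo n)

  ∑-upTo⁺ : ∀ n f → ∑ (upTo⁺ n) f ≡ ∑< n (f ∘ suc)
  ∑-upTo⁺ n f = ≡.trans (∑-map suc (upTo n) f) (∑-applyUpTo id n (f ∘ suc))

  indicator : ∀ {p} {P : Set p} → Dec P → Carrier
  indicator P? = guarded₀ P? 1#

  ∑<-*ˡ : ∀ n k u → ∑< n (λ i → k * u i) ≈ k * ∑< n u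
  ∑<-*ˡ zero    k u = ≈-sym (zeroʳ k)
  ∑<-*ˡ (suc n) k u = ≈-trans (+-congˡ (∑<-*ˡ n k (u ∘ suc))) (≈-sym (distribˡ _ _ _))

  -- Shifting by one trades u 0 for u n, which are equal by periodicity, and the shifted sequence is
  -- periodic again.
  ∑<-shift : ∀ n u → (∀ i → u (n ℕ.+ i) ≈ u i) → ∀ s → ∑< n (λ i → u (s ℕ.+ i)) ≈ ∑< n u
  ∑<-shift n u periodic zero    = ≈-refl
  ∑<-shift n u periodic (suc s) = ≈-trans
    (∑<-shift n (u ∘ suc) (λ i → ≈-trans (reflexive (cong u (≡.sym (ℕₚ.+-suc n i)))) (periodic (suc i))) s)
    shiftByOne
    where
    shiftByOne : ∑< n (u ∘ suc) ≈ ∑< n u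
    shiftByOne = +-cancelˡ (u 0) _ _ (begin
      ∑< (suc n) u      ≈⟨ ∑<-last n u ⟩
      ∑< n u + u n      ≈⟨ +-comm _ _ ⟩
      u n + ∑< n u      ≈⟨ +-congʳ (≈-trans (reflexive (cong u (≡.sym (ℕₚ.+-identityʳ n)))) (periodic 0)) ⟩
      u 0 + ∑< n u      ∎)

  -- Here y will be a power of ω, in general not primitive. The dichotomy is a hypothesis because it
  -- cannot be decided in K; for powers of ω it is read off from the exponent.
  module _ (n : ℕ) (y : Carrier) (yⁿ≈1 : pow K y n ≈ 1#)
           (one-or-not : ∀ m → (pow K y m ≈ 1#) ⊎ Invertible (pow K y m - 1#)) where

    module _ (D : ℕ) (D∣n : D ∣ n) where

      multiplePower : ℕ → Carrier
      multiplePower k = indicator (D ∣? k) * pow K y k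

      multiplePower-+ : ∀ m k → D ∣ m → multiplePower (m ℕ.+ k) ≈ pow K y m * multiplePower k
      multiplePower-+ m k D∣m with D ∣? k | D ∣? (m ℕ.+ k)
      ... | yes _   | yes _   = ≈-trans (*-congˡ (pow-+ y m k)) (solve 2 (λ a b → con (+ 1) :* (a :* b) := a :* (con (+ 1) :* b)) ≈-refl _ _)
      ... | no  _   | no  _   = ≈-trans (zeroˡ _) (≈-sym (≈-trans (*-congˡ (zeroˡ _)) (zeroʳ _)))
      ... | yes D∣k | no  D∤  = ⊥-elim (D∤ (∣m∣n⇒∣m+n D∣m D∣k))
      ... | no  D∤k | yes D∣  = ⊥-elim (D∤k (∣m+n∣m⇒∣n D∣ D∣m))

      ∑-multiplePower : Carrier
      ∑-multiplePower = ∑< n (multiplePower ∘ suc)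

      -- Replacing k by k + D permutes the multiples of D modulo n and multiplies each summand by y ^ D.
      shift-invariant : pow K y D * ∑-multiplePower ≈ ∑-multiplePower
      shift-invariant = begin
        pow K y D * ∑< n (multiplePower ∘ suc)                ≈⟨ ∑<-*ˡ n (pow K y D) _ ⟨
        ∑< n (λ i → pow K y D * multiplePower (suc i))        ≈⟨ ∑<-cong n (λ i _ → shift D i ∣-refl) ⟨
        ∑< n (λ i → multiplePower (suc (D ℕ.+ i)))            ≈⟨ ∑<-shift n (multiplePower ∘ suc) periodic D ⟩
        ∑< n (multiplePower ∘ suc)                            ∎
        where
        shift : ∀ m i → D ∣ m → multiplePower (suc (m ℕ.+ i)) ≈ pow K y m * multiplePower (suc i)
        shift m i D∣m = ≈-trans (reflexive (cong multiplePower (≡.sym (ℕₚ.+-suc m i)))) (multiplePower-+ m (suc i) D∣m)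

        periodic : ∀ i → multiplePower (suc (n ℕ.+ i)) ≈ multiplePower (suc i)
        periodic i = ≈-trans (shift n i D∣n) (≈-trans (*-congʳ yⁿ≈1) (*-identityˡ _))

      -- If y ^ D = 1, every summand is 0 or 1. Otherwise shift invariance says that (y ^ D - 1)
      -- times the sum vanishes, with an invertible first factor.
      int-∑-multiplePower : IsInt ∑-multiplePower
      int-∑-multiplePower with one-or-not D
      ... | inj₁ yᴰ≈1 = int-∑< n (int-term ∘ suc)
        where
        int-term : ∀ k → IsInt (multiplePower k)
        int-term k with D ∣? k
        ... | yes (divides q refl) = int-resp (≈-trans (*-identityˡ _) (≈-trans (pow-* y q D)
                                       (≈-trans (pow-cong q yᴰ≈1) (pow-1# q)))) int-1
        ... | no  _                = int-resp (zeroˡ _) int-0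
      ... | inj₂ inv = int-resp (*-cancelˡ-invertible inv (begin
        (pow K y D - 1#) * ∑-multiplePower
          ≈⟨ solve 2 (λ p s → (p :- con (+ 1)) :* s := p :* s :- s) ≈-refl (pow K y D) ∑-multiplePower ⟩
        pow K y D * ∑-multiplePower - ∑-multiplePower
          ≈⟨ +-congʳ shift-invariant ⟩
        ∑-multiplePower - ∑-multiplePower
          ≈⟨ -‿inverseʳ _ ⟩
        0#
          ≈⟨ zeroʳ _ ⟨
        (pow K y D - 1#) * 0# ∎)) int-0

    -- Inclusion-exclusion in product form, to be expanded one factor at a time; no Möbius function
    -- appears.
    sieve : List ℕ → ℕ → Carrier
    sieve qs k = ∏ qs (λ q → 1# - indicator (q ∣? k))

    indicator-lcm : ∀ q D k → indicator (lcm q D ∣? k) ≈ indicator (q ∣? k) * indicator (D ∣? k)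
    indicator-lcm q D k with lcm q D ∣? k | q ∣? k | D ∣? k
    ... | yes _ | yes _  | yes _  = ≈-sym (*-identityˡ 1#)
    ... | yes l | no q∤k | _      = ⊥-elim (q∤k (∣-trans (m∣lcm[m,n] q D) l))
    ... | yes l | yes _  | no D∤k = ⊥-elim (D∤k (∣-trans (n∣lcm[m,n] q D) l))
    ... | no l∤ | yes q∣ | yes D∣ = ⊥-elim (l∤ (lcm-least q∣ D∣))
    ... | no _  | no _   | _      = ≈-sym (zeroˡ _)
    ... | no _  | yes _  | no _   = ≈-sym (zeroʳ _)

    -- The additional condition D ∣ k carries the induction: expanding the factor 1 - [q ∣ k] leaves
    -- two sums over the shorter sieve, one with D and one with lcm q D, both divisors of n.
    int-∑-sieve : ∀ qs → (∀ {q} → q ∈ qs → q ∣ n) → ∀ D → D ∣ n →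
                  IsInt (∑ (upTo⁺ n) (λ k → indicator (D ∣? k) * sieve qs k * pow K y k))
    int-∑-sieve [] _ D D∣n = int-resp
      (≈-trans (∑-cong (upTo⁺ n) (λ k → *-congʳ (*-identityʳ _))) (reflexive (∑-upTo⁺ n (multiplePower D D∣n))))
      (int-∑-multiplePower D D∣n)
    int-∑-sieve (q ∷ qs) qs∣n D D∣n = int-resp (begin
      ∑ (upTo⁺ n) (λ k → indicator (D ∣? k) * sieve (q ∷ qs) k * pow K y k)
        ≈⟨ ∑-cong (upTo⁺ n) split ⟩
      ∑ (upTo⁺ n) (λ k → indicator (D ∣? k) * sieve qs k * pow K y k + - 1# * (indicator (lcm q D ∣? k) * sieve qs k * pow K y k))
        ≈⟨ ∑-+ (upTo⁺ n) _ _ ⟩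
      ∑ (upTo⁺ n) (λ k → indicator (D ∣? k) * sieve qs k * pow K y k) +
      ∑ (upTo⁺ n) (λ k → - 1# * (indicator (lcm q D ∣? k) * sieve qs k * pow K y k))
        ≈⟨ +-congˡ (∑-*ˡ (upTo⁺ n) (- 1#) _) ⟩
      ∑ (upTo⁺ n) (λ k → indicator (D ∣? k) * sieve qs k * pow K y k) +
      - 1# * ∑ (upTo⁺ n) (λ k → indicator (lcm q D ∣? k) * sieve qs k * pow K y k) ∎)
      (int-+ (int-∑-sieve qs (qs∣n ∘ there) D D∣n)
        (int-* (int-neg int-1) (int-∑-sieve qs (qs∣n ∘ there) (lcm q D) (lcm-least (qs∣n (here refl)) D∣n))))
      where
      split : ∀ k → indicator (D ∣? k) * sieve (q ∷ qs) k * pow K y k ≈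
                    indicator (D ∣? k) * sieve qs k * pow K y k + - 1# * (indicator (lcm q D ∣? k) * sieve qs k * pow K y k)
      split k = ≈-trans
        (solve 4 (λ d q s p → d :* ((con (+ 1) :- q) :* s) :* p := d :* s :* p :+ :- con (+ 1) :* ((q :* d) :* s :* p))
          ≈-refl (indicator (D ∣? k)) (indicator (q ∣? k)) (sieve qs k) (pow K y k))
        (+-congˡ (*-congˡ (*-congʳ (*-congʳ (≈-sym (indicator-lcm q D k))))))

    module _ .{{_ : NonZero n}} where

      isNontrivialDivisor? : ∀ q → Dec (q ∣ n × ¬ (q ≡ 1))
      isNontrivialDivisor? q = (q ∣? n) ×-dec ¬? (q ℕ.≟ 1)

      nontrivialDivisors : List ℕ
      nontrivialDivisors = filter isNontrivialDivisor? (upTo (suc n))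

      -- If gcd k n is not 1, it is itself a nontrivial divisor of n and its factor vanishes.
      -- Listing all divisors rather than the primes makes this immediate.
      sieve-coprime : ∀ k → sieve nontrivialDivisors k ≈ indicator (gcd k n ℕ.≟ 1)
      sieve-coprime k with gcd k n ℕ.≟ 1
      ... | yes gcd≡1 = ∏≈1 nontrivialDivisors (λ q∈ → proj₂ (∈-filter⁻ isNontrivialDivisor? {xs = upTo (suc n)} q∈))
        where
        ∏≈1 : ∀ qs → (∀ {q} → q ∈ qs → q ∣ n × ¬ (q ≡ 1)) → sieve qs k ≈ 1#
        ∏≈1 []       _ = ≈-refl
        ∏≈1 (q ∷ qs) nontrivial with q ∣? k | nontrivial (here refl)
        ... | yes q∣k | q∣n , q≢1 = ⊥-elim (q≢1 (∣1⇒≡1 (subst (q ∣_) gcd≡1 (gcd-greatest q∣k q∣n))))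
        ... | no  _   | _         = ≈-trans (*-congˡ (∏≈1 qs (nontrivial ∘ there)))
                                      (solve 0 ((con (+ 1) :- con (+ 0)) :* con (+ 1) := con (+ 1)) ≈-refl)
      ... | no gcd≢1 = ∏≈0 nontrivialDivisors (∈-filter⁺ isNontrivialDivisor?
                         (∈-upTo⁺ (s≤s (∣⇒≤ (gcd[m,n]∣n k n)))) (gcd[m,n]∣n k n , gcd≢1))
        where
        ∏≈0 : ∀ qs → gcd k n ∈ qs → sieve qs k ≈ 0#
        ∏≈0 (q ∷ qs) (here refl) with gcd k n ∣? k
        ... | yes _  = ≈-trans (*-congʳ (-‿inverseʳ 1#)) (zeroˡ _)
        ... | no  ∤k = ⊥-elim (∤k (gcd[m,n]∣m k n))
        ∏≈0 (q ∷ qs) (there p) = ≈-trans (*-congˡ (∏≈0 qs p)) (zeroʳ _)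

      int-∑-coprime : IsInt (∑ (coprimeExps K n) (pow K y))
      int-∑-coprime = int-resp (≈-trans (∑-filter (λ k → gcd k n ℕ.≟ 1) (upTo⁺ n) (pow K y)) (∑-cong (upTo⁺ n) term))
        (int-∑-sieve nontrivialDivisors (λ q∈ → proj₁ (proj₂ (∈-filter⁻ isNontrivialDivisor? {xs = upTo (suc n)} q∈))) 1 (divides n (≡.sym (ℕₚ.*-identityʳ n))))
        where
        guarded≈ : ∀ {p} {P : Set p} (P? : Dec P) x → guarded₀ P? x ≈ indicator P? * x
        guarded≈ (yes _) x = ≈-sym (*-identityˡ x)
        guarded≈ (no  _) x = ≈-sym (zeroˡ x)

        one-divides : ∀ k → indicator (1 ∣? k) ≈ 1#
        one-divides k with 1 ∣? k
        ... | yes _  = ≈-refl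
        ... | no 1∤k = ⊥-elim (1∤k (divides k (≡.sym (ℕₚ.*-identityʳ k))))

        term : ∀ k → guarded₀ (gcd k n ℕ.≟ 1) (pow K y k) ≈ indicator (1 ∣? k) * sieve nontrivialDivisors k * pow K y k
        term k = begin
          guarded₀ (gcd k n ℕ.≟ 1) (pow K y k)                               ≈⟨ guarded≈ (gcd k n ℕ.≟ 1) (pow K y k) ⟩
          indicator (gcd k n ℕ.≟ 1) * pow K y k                              ≈⟨ *-congʳ (sieve-coprime k) ⟨
          sieve nontrivialDivisors k * pow K y k                             ≈⟨ *-congʳ (*-identityˡ _) ⟨
          1# * sieve nontrivialDivisors k * pow K y k                        ≈⟨ *-congʳ (*-congʳ (one-divides k)) ⟨
          indicator (1 ∣? k) * sieve nontrivialDivisors k * pow K y k        ∎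

  module _ (n : ℕ) (1<n : 1 < n) (ω : Carrier) (isPrimitive : IsPrimitiveRoot K n ω) where

    private instance
      n-nonZero : NonZero n
      n-nonZero = ℕ.>-nonZero (ℕₚ.<-trans (s≤s z≤n) 1<n)

    pow-ω-% : ∀ m → pow K ω m ≈ pow K ω (m % n)
    pow-ω-% m = begin
      pow K ω m                                      ≡⟨ cong (pow K ω) (m≡m%n+[m/n]*n m n) ⟩
      pow K ω (m % n ℕ.+ (m / n) ℕ.* n)              ≈⟨ pow-+ ω (m % n) ((m / n) ℕ.* n) ⟩
      pow K ω (m % n) * pow K ω ((m / n) ℕ.* n)      ≈⟨ *-congˡ (pow-* ω (m / n) n) ⟩
      pow K ω (m % n) * pow K (pow K ω n) (m / n)    ≈⟨ *-congˡ (pow-cong (m / n) (proj₁ isPrimitive)) ⟩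
      pow K ω (m % n) * pow K 1# (m / n)             ≈⟨ *-congˡ (pow-1# (m / n)) ⟩
      pow K ω (m % n) * 1#                           ≈⟨ *-identityʳ _ ⟩
      pow K ω (m % n)                                ∎

    pow-ω-one-or-not : ∀ m → (pow K ω m ≈ 1#) ⊎ Invertible (pow K ω m - 1#)
    pow-ω-one-or-not m with m % n | pow-ω-% m | m%n<n m n
    ... | zero  | ωᵐ≈ | _   = inj₁ ωᵐ≈
    ... | suc r | ωᵐ≈ | r<n = inj₂ (invertible-difference (λ ωᵐ≈1 →
                                proj₂ isPrimitive (suc r) (s≤s z≤n) r<n (≈-trans (≈-sym ωᵐ≈) ωᵐ≈1)))

    primitiveRoots : List Carrier
    primitiveRoots = map (pow K ω) (coprimeExps K n)

    -- Exchanging the two exponents gives the sum of (ω ^ j) ^ k over the k coprime to n, so the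
    -- sieve applies with y = ω ^ j.
    int-psum-primitiveRoots : ∀ j → IsInt (psum j primitiveRoots)
    int-psum-primitiveRoots j = int-resp
      (≈-trans (reflexive (∑-map (pow K ω) (coprimeExps K n) (λ x → pow K x j)))
        (∑-cong (coprimeExps K n) (λ k → commute k j)))
      (int-∑-coprime n (pow K ω j) ωʲⁿ≈1 (λ m → subst-power m (pow-ω-one-or-not (m ℕ.* j))))
      where
      commute : ∀ k j → pow K (pow K ω k) j ≈ pow K (pow K ω j) k
      commute k j = ≈-trans (≈-sym (pow-* ω j k)) (≈-trans (reflexive (cong (pow K ω) (ℕₚ.*-comm j k))) (pow-* ω k j))

      ωʲⁿ≈1 : pow K (pow K ω j) n ≈ 1#
      ωʲⁿ≈1 = ≈-trans (commute j n) (≈-trans (pow-cong j (proj₁ isPrimitive)) (pow-1# j))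

      subst-power : ∀ m → (pow K ω (m ℕ.* j) ≈ 1#) ⊎ Invertible (pow K ω (m ℕ.* j) - 1#) →
                    (pow K (pow K ω j) m ≈ 1#) ⊎ Invertible (pow K (pow K ω j) m - 1#)
      subst-power m (inj₁ eq)           = inj₁ (≈-trans (≈-sym (pow-* ω m j)) eq)
      subst-power m (inj₂ (z , inv))    = inj₂ (z , ≈-trans (*-congʳ (+-congʳ (≈-sym (pow-* ω m j)))) inv)

    -- `coprimeExps` ranges over 1, ..., n. Excluding the exponent n is where n > 1 matters: the
    -- rest of the range is stable under k ↦ n - k.
    gcd[n,n]≢1 : ¬ (gcd n n ≡ 1)
    gcd[n,n]≢1 gcd≡1 = ℕₚ.<⇒≢ 1<n (≡.sym (∣1⇒≡1 (subst (n ∣_) gcd≡1 (gcd-greatest ∣-refl ∣-refl))))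

    coprimeExps-bounds : ∀ {k} → k ∈ coprimeExps K n → 0 < k × k < n
    coprimeExps-bounds k∈ with ∈-filter⁻ (λ k → gcd k n ℕ.≟ 1) {xs = upTo⁺ n} k∈
    ... | k∈upTo⁺ , gcd≡1 with ∈-map⁻ suc k∈upTo⁺
    ... | i , i∈upTo , refl = s≤s z≤n , ℕₚ.≤∧≢⇒< (∈-upTo⁻ i∈upTo) (λ { refl → gcd[n,n]≢1 gcd≡1 })

    gcd-complement : ∀ {k} → k ≤ n → gcd k n ≡ 1 → gcd (n ∸ k) n ≡ 1
    gcd-complement {k} k≤n gcd≡1 = ∣1⇒≡1 (subst (gcd (n ∸ k) n ∣_) gcd≡1 (gcd-greatest
      (∣m+n∣m⇒∣n (subst (gcd (n ∸ k) n ∣_) (≡.sym (ℕₚ.m∸n+n≡m k≤n)) (gcd[m,n]∣n (n ∸ k) n)) (gcd[m,n]∣m (n ∸ k) n))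
      (gcd[m,n]∣n (n ∸ k) n)))

    guarded-complement : ∀ {k} → k ≤ n → ∀ x → guarded₁ (gcd (n ∸ k) n ℕ.≟ 1) x ≈ guarded₁ (gcd k n ℕ.≟ 1) x
    guarded-complement {k} k≤n x with gcd (n ∸ k) n ℕ.≟ 1 | gcd k n ℕ.≟ 1
    ... | yes _ | yes _ = ≈-refl
    ... | no  _ | no  _ = ≈-refl
    ... | yes p | no ¬q = ⊥-elim (¬q (≡.trans (cong (λ i → gcd i n) (≡.sym (ℕₚ.m∸[m∸n]≡n k≤n))) (gcd-complement (ℕₚ.m∸n≤m n k) p)))
    ... | no ¬p | yes q = ⊥-elim (¬p (gcd-complement k≤n q))

    ∏-coprimeExps : ∀ g → ∏ (coprimeExps K n) g ≈ ∏< (n ∸ 1) (λ i → guarded₁ (gcd (suc i) n ℕ.≟ 1) (g (suc i)))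
    ∏-coprimeExps g = begin
      ∏ (coprimeExps K n) g                       ≈⟨ ∏-filter (λ k → gcd k n ℕ.≟ 1) (upTo⁺ n) g ⟩
      ∏ (upTo⁺ n) w                               ≡⟨ ⨁-map suc (upTo n) w ⟩
      ∏ (upTo n) (w ∘ suc)                        ≡⟨ ∏-applyUpTo id n (w ∘ suc) ⟩
      ∏< n (w ∘ suc)                              ≡⟨ cong (λ m → ∏< m (w ∘ suc)) n≡ ⟨
      ∏< (suc (n ∸ 1)) (w ∘ suc)                  ≈⟨ ∏<-last (n ∸ 1) (w ∘ suc) ⟩
      ∏< (n ∸ 1) (w ∘ suc) * w (suc (n ∸ 1))      ≈⟨ *-congˡ (≈-trans (reflexive (cong w n≡)) last≈1) ⟩
      ∏< (n ∸ 1) (w ∘ suc) * 1#                   ≈⟨ *-identityʳ _ ⟩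
      ∏< (n ∸ 1) (w ∘ suc)                        ∎
      where
      w : ℕ → Carrier
      w k = guarded₁ (gcd k n ℕ.≟ 1) (g k)

      n≡ : suc (n ∸ 1) ≡ n
      n≡ = ℕₚ.m+[n∸m]≡n (ℕₚ.<⇒≤ 1<n)

      last≈1 : w n ≈ 1#
      last≈1 with gcd n n ℕ.≟ 1
      ... | yes eq = ⊥-elim (gcd[n,n]≢1 eq)
      ... | no  _  = ≈-refl

    ∏-coprimeExps-complement : ∀ g → ∏ (coprimeExps K n) (λ k → g (n ∸ k)) ≈ ∏ (coprimeExps K n) g
    ∏-coprimeExps-complement g = begin
      ∏ (coprimeExps K n) (λ k → g (n ∸ k))
        ≈⟨ ∏-coprimeExps (λ k → g (n ∸ k)) ⟩
      ∏< (n ∸ 1) (λ i → guarded₁ (gcd (suc i) n ℕ.≟ 1) (g (n ∸ suc i)))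
        ≈⟨ ∏<-cong (n ∸ 1) reflect ⟩
      ∏< (n ∸ 1) (λ i → w (suc (n ∸ 1 ∸ suc i)))
        ≈⟨ ∏<-reverse (n ∸ 1) (w ∘ suc) ⟩
      ∏< (n ∸ 1) (w ∘ suc)
        ≈⟨ ∏-coprimeExps g ⟨
      ∏ (coprimeExps K n) g ∎
      where
      w : ℕ → Carrier
      w k = guarded₁ (gcd k n ℕ.≟ 1) (g k)

      -- The index i stands for the exponent i + 1, so n - (i + 1) has to be written as the
      -- successor of the reversed index.
      reflect : ∀ i → i < n ∸ 1 → guarded₁ (gcd (suc i) n ℕ.≟ 1) (g (n ∸ suc i)) ≈ w (suc (n ∸ 1 ∸ suc i))
      reflect i i<n-1 = ≈-trans (≈-sym (guarded-complement (ℕₚ.≤-trans i<n-1 (ℕₚ.m∸n≤m n 1)) _))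
        (reflexive (cong w (≡.trans (≡.sym (ℕₚ.∸-+-assoc n 1 i)) (ℕₚ.+-∸-assoc 1 i<n-1))))

    form : Carrier → Carrier → Carrier
    form a b = ∏ (coprimeExps K n) (λ k → a - pow K ω k * b)

    -- This is Φₙ(0), the value of the form at (0 , 1).
    constantTerm : Carrier
    constantTerm = ∏ (coprimeExps K n) (λ k → - pow K ω k)

    -- Each factor satisfies b - ζ a = - ζ (a - ζ⁻¹ b), and inversion permutes the primitive roots;
    -- on exponents it is k ↦ n - k.
    form-flip : ∀ a b → form b a ≈ constantTerm * form a b
    form-flip a b = begin
      ∏ (coprimeExps K n) (λ k → b - pow K ω k * a)
        ≈⟨ ∏-cong-∈ (coprimeExps K n) flipFactor ⟩
      ∏ (coprimeExps K n) (λ k → - pow K ω k * (a - pow K ω (n ∸ k) * b))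
        ≈⟨ ∏-* (coprimeExps K n) _ _ ⟩
      constantTerm * ∏ (coprimeExps K n) (λ k → a - pow K ω (n ∸ k) * b)
        ≈⟨ *-congˡ (∏-coprimeExps-complement (λ k → a - pow K ω k * b)) ⟩
      constantTerm * form a b ∎
      where
      flipFactor : ∀ {k} → k ∈ coprimeExps K n → b - pow K ω k * a ≈ - pow K ω k * (a - pow K ω (n ∸ k) * b)
      flipFactor {k} k∈ = begin
        b - pow K ω k * a
          ≈⟨ +-congʳ (*-identityˡ b) ⟨
        1# * b - pow K ω k * a
          ≈⟨ +-congʳ (*-congʳ (≈-trans (≈-sym (proj₁ isPrimitive)) (≈-trans
               (reflexive (cong (pow K ω) (≡.sym (ℕₚ.m+[n∸m]≡n (ℕₚ.<⇒≤ (proj₂ (coprimeExps-bounds k∈)))))))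
               (pow-+ ω k (n ∸ k))))) ⟩
        pow K ω k * pow K ω (n ∸ k) * b - pow K ω k * a
          ≈⟨ solve 4 (λ a b p q → p :* q :* b :- p :* a := :- p :* (a :- q :* b)) ≈-refl a b (pow K ω k) (pow K ω (n ∸ k)) ⟩
        - pow K ω k * (a - pow K ω (n ∸ k) * b) ∎

    -- The value at (1 , 1) is invertible because n > 1, which forces the constant term to be 1.
    constantTerm≈1 : constantTerm ≈ 1#
    constantTerm≈1 = *-cancelˡ-invertible invertible-form (begin
      form 1# 1# * constantTerm    ≈⟨ *-comm _ _ ⟩
      constantTerm * form 1# 1#    ≈⟨ form-flip 1# 1# ⟨
      form 1# 1#                   ≈⟨ *-identityʳ _ ⟨
      form 1# 1# * 1#              ∎)
      where
      invertible-form : Invertible (form 1# 1#)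
      invertible-form = invertible-∏ (coprimeExps K n) (λ {k} k∈ → invertible-difference (λ 1≈ωᵏ →
        proj₂ isPrimitive k (proj₁ (coprimeExps-bounds k∈)) (proj₂ (coprimeExps-bounds k∈))
          (≈-sym (≈-trans 1≈ωᵏ (*-identityʳ _)))))

    form-symmetric : ∀ a b → form a b ≈ form b a
    form-symmetric a b = ≈-sym (≈-trans (form-flip a b) (≈-trans (*-congʳ constantTerm≈1) (*-identityˡ _)))

-- The product over pairs of roots as an integer polynomial, and its integrality

prodExpr : List Expr → Expr
prodExpr = foldr _⊗_ (con (+ 1))

powExpr : Expr → ℕ → Expr
powExpr f zero    = con (+ 1)
powExpr f (suc t) = f ⊗ powExpr f t

formExpr : List Expr → Expr → Expr → Expr
formExpr zs a b = prodExpr (map (λ z → a ⊕ con (ℤ.- + 1) ⊗ (z ⊗ b)) zs)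

pairProductExpr : List Expr → List Expr → Expr
pairProductExpr zs []       = con (+ 1)
pairProductExpr zs (a ∷ as) = prodExpr (map (formExpr zs a) as) ⊗ pairProductExpr zs as

module PairProducts {c ℓ : Level} (K : CommutativeRing c ℓ) where
  open RingLemmas K
  open Integrality K
  open PowerSums K
  open Symmetrisation K
  open import Relation.Binary.Reasoning.Setoid setoid
  open BigOperator *-commutativeMonoid
    renaming (⨁ to ∏; ⨁-cong to ∏-cong; ⨁-∙ to ∏-*; ⨁-++ to ∏-++; ⨁-↭ to ∏-↭; ⨁-map to ∏-map)

  -- The product over `pairs` in recursive form, suited to induction on permutations.
  pairProduct : (Carrier → Carrier → Carrier) → List Carrier → Carrier
  pairProduct h []       = 1#
  pairProduct h (a ∷ as) = ∏ as (h a) * pairProduct h as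

  pairProduct-cong : ∀ {h h′} → (∀ a b → h a b ≈ h′ a b) → ∀ as → pairProduct h as ≈ pairProduct h′ as
  pairProduct-cong h≈h′ []       = ≈-refl
  pairProduct-cong h≈h′ (a ∷ as) = *-cong (∏-cong as (h≈h′ a)) (pairProduct-cong h≈h′ as)

  pairProduct-* : ∀ h h′ as → pairProduct (λ a b → h a b * h′ a b) as ≈ pairProduct h as * pairProduct h′ as
  pairProduct-* h h′ []       = ≈-sym (*-identityˡ 1#)
  pairProduct-* h h′ (a ∷ as) = ≈-trans (*-cong (∏-* as _ _) (pairProduct-* h h′ as)) (interchange _ _ _ _)

  -- Exchanging two neighbours a and b reverses the arguments of the single factor h a b and merely
  -- reorders the others.
  pairProduct-↭ : ∀ {h} → (∀ a b → h a b ≈ h b a) → ∀ {as bs} → as ↭ bs → pairProduct h as ≈ pairProduct h bs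
  pairProduct-↭ h-sym Perm.refl        = ≈-refl
  pairProduct-↭ h-sym (prep a p)       = *-cong (∏-↭ _ p) (pairProduct-↭ h-sym p)
  pairProduct-↭ {h} h-sym (swap {as} {bs} a b p) = begin
    h a b * ∏ as (h a) * (∏ as (h b) * pairProduct h as)
      ≈⟨ *-cong (*-cong (h-sym a b) (∏-↭ (h a) p)) (*-cong (∏-↭ (h b) p) (pairProduct-↭ h-sym p)) ⟩
    h b a * ∏ bs (h a) * (∏ bs (h b) * pairProduct h bs)
      ≈⟨ solve 4 (λ x y z w → x :* y :* (z :* w) := x :* z :* (y :* w)) ≈-refl _ _ _ _ ⟩
    h b a * ∏ bs (h b) * (∏ bs (h a) * pairProduct h bs) ∎
  pairProduct-↭ h-sym (Perm.trans p q) = ≈-trans (pairProduct-↭ h-sym p) (pairProduct-↭ h-sym q)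

  ∏-pairs : ∀ (h : Carrier × Carrier → Carrier) as → ∏ (pairs K as) h ≈ pairProduct (λ a b → h (a , b)) as
  ∏-pairs h []       = ≈-refl
  ∏-pairs h (a ∷ as) = ≈-trans (∏-++ (map (a ,_) as) (pairs K as) h)
    (*-cong (reflexive (∏-map (a ,_) as h)) (∏-pairs h as))

  binaryForm : List Carrier → Carrier → Carrier → Carrier
  binaryForm zs a b = ∏ zs (λ z → a - z * b)

  module _ (rest env : List Carrier) where

    private
      val : Expr → Carrier
      val f = ⟦ f ⟧ rest env

    ⟦prodExpr⟧ : ∀ {a} {A : Set a} (xs : List A) (f : A → Expr) → val (prodExpr (map f xs)) ≈ ∏ xs (val ∘ f)
    ⟦prodExpr⟧ []       f = +-identityʳ 1#
    ⟦prodExpr⟧ (x ∷ xs) f = *-congˡ (⟦prodExpr⟧ xs f)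

    ⟦powExpr⟧ : ∀ f t → val (powExpr f t) ≈ pow K (val f) t
    ⟦powExpr⟧ f zero    = +-identityʳ 1#
    ⟦powExpr⟧ f (suc t) = *-congˡ (⟦powExpr⟧ f t)

    ⟦formExpr⟧ : ∀ zs a b → val (formExpr zs a b) ≈ binaryForm (map val zs) (val a) (val b)
    ⟦formExpr⟧ zs a b = ≈-trans (⟦prodExpr⟧ zs _) (≈-trans (∏-cong zs (λ z →
        solve 3 (λ a b z → a :+ :- (con (+ 1) :+ con (+ 0)) :* (z :* b) := a :- z :* b) ≈-refl (val a) (val b) (val z)))
      (reflexive (≡.sym (∏-map val zs (λ z → val a - z * val b)))))

    ⟦pairProductExpr⟧ : ∀ zs as → val (pairProductExpr zs as) ≈ pairProduct (binaryForm (map val zs)) (map val as)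
    ⟦pairProductExpr⟧ zs []       = +-identityʳ 1#
    ⟦pairProductExpr⟧ zs (a ∷ as) = *-cong
      (≈-trans (⟦prodExpr⟧ as (formExpr zs a)) (≈-trans (∏-cong as (⟦formExpr⟧ zs a))
        (reflexive (≡.sym (∏-map val as (binaryForm (map val zs) (val a)))))))
      (⟦pairProductExpr⟧ zs as)

  applyUpTo-coeff : ∀ (g : ℕ → Carrier) xs ys → (∀ i → g i ≡ coeff i (xs ++ ys)) → applyUpTo g (length xs) ≡ xs
  applyUpTo-coeff g []       ys _  = refl
  applyUpTo-coeff g (x ∷ xs) ys g≡ = cong₂ _∷_ (g≡ 0) (applyUpTo-coeff (g ∘ suc) xs ys (g≡ ∘ suc))

  coeff-++ : ∀ xs ys i → coeff (length xs ℕ.+ i) (xs ++ ys) ≡ coeff i ys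
  coeff-++ []       ys i = refl
  coeff-++ (x ∷ xs) ys i = coeff-++ xs ys i

  module _ (φ d t : ℕ) where

    -- The ζ's take the first φ variables and the α's the next d, because elimination works from the
    -- front of the environment and the ζ's go first.
    powerExpr : Expr
    powerExpr = powExpr (pairProductExpr (applyUpTo var φ) (applyUpTo (λ i → var (φ ℕ.+ i)) d)) t

    ⟦powerExpr⟧ : ∀ rest zs as → length zs ≡ φ → length as ≡ d →
                  ⟦ powerExpr ⟧ rest (zs ++ as) ≈ pow K (pairProduct (binaryForm zs) as) t
    ⟦powerExpr⟧ rest zs as refl refl = begin
      val powerExpr
        ≈⟨ ⟦powExpr⟧ rest (zs ++ as) _ t ⟩
      pow K (val (pairProductExpr zVars aVars)) t
        ≈⟨ pow-cong t (⟦pairProductExpr⟧ rest (zs ++ as) zVars aVars) ⟩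
      pow K (pairProduct (binaryForm (map val zVars)) (map val aVars)) t
        ≡⟨ cong₂ (λ zs as → pow K (pairProduct (binaryForm zs) as) t)
             (≡.trans (Listₚ.map-applyUpTo var val φ) (applyUpTo-coeff _ zs as (λ _ → refl)))
             (≡.trans (Listₚ.map-applyUpTo (λ i → var (φ ℕ.+ i)) val d) (applyUpTo-coeff _ as []
               (λ i → ≡.trans (coeff-++ zs as i) (cong (coeff i) (≡.sym (Listₚ.++-identityʳ as)))))) ⟩
      pow K (pairProduct (binaryForm zs) as) t ∎
      where
      val : Expr → Carrier
      val f = ⟦ f ⟧ rest (zs ++ as)
      zVars aVars : List Expr
      zVars = applyUpTo var φ
      aVars = applyUpTo (λ i → var (φ ℕ.+ i)) d

  module _ (zs as : List Carrier)
           (int-zs : ∀ j → IsInt (psum j zs)) (int-as : ∀ j → IsInt (psum j as))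
           (form-symmetric : ∀ a b → binaryForm zs a b ≈ binaryForm zs b a) where

    private
      φ = length zs
      d = length as

    denominator : ℕ
    denominator = d ! ℕ.* φ !

    int-denominator-* : ∀ t → IsInt (fromℕ K denominator * pow K (pairProduct (binaryForm zs) as) t)
    int-denominator-* t = int-resp (≈-trans
        (≈-trans (*-congʳ (fromℕ-* (d !) (φ !))) (*-assoc _ _ _))
        (≈-sym (⟦eliminateMany⟧ averaged _ d as [] refl averaged≈)))
      (int-⟦⟧ as int-as (eliminateMany d averaged))
      where
      averaged : Expr
      averaged = substPsums (proj₁ ∘ int-zs) (eliminateMany φ (powerExpr φ d t))

      -- The two symmetries have different origins: permuting the ζ's only reorders the factors of
      -- each form, whereas permuting the α's requires the form to be symmetric in its two
      -- arguments.
      averaged≈ : ∀ bs → bs ↭ as →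
        ⟦ averaged ⟧ [] (bs ++ []) ≈ fromℕ K (φ !) * pow K (pairProduct (binaryForm zs) as) t
      averaged≈ bs bs↭as = begin
        ⟦ averaged ⟧ [] (bs ++ [])
          ≡⟨ cong (⟦ averaged ⟧ []) (Listₚ.++-identityʳ bs) ⟩
        ⟦ averaged ⟧ [] bs
          ≈⟨ ⟦substPsums⟧ zs int-zs (eliminateMany φ (powerExpr φ d t)) [] bs ⟩
        ⟦ eliminateMany φ (powerExpr φ d t) ⟧ zs bs
          ≈⟨ ⟦eliminateMany⟧ (powerExpr φ d t) _ φ zs bs refl (λ ws ws↭zs → ≈-trans
               (⟦powerExpr⟧ φ d t [] ws bs (Permₚ.↭-length ws↭zs) (Permₚ.↭-length bs↭as))
               (pow-cong t (≈-trans (pairProduct-cong (λ a b → ∏-↭ (λ z → a - z * b) ws↭zs) bs)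
                 (pairProduct-↭ form-symmetric bs↭as)))) ⟩
        fromℕ K (φ !) * pow K (pairProduct (binaryForm zs) as) t ∎

    int-pairProduct : IsField K → CharZero K → IsInt (pairProduct (binaryForm zs) as)
    int-pairProduct isField charZero = bounded-denominator⇒int charZero isField denominator
      {{ℕₚ._!*_!≢0 d φ}} _ int-denominator-*

-- Integer coefficients of the polynomial, and the conclusion

module IntegerCoefficients {c ℓ : Level} (K : CommutativeRing c ℓ) where
  open RingLemmas K
  open Integrality K
  open PowerSums K

  int-coeff-monicPoly : ∀ (cs : List ℤ) i → IsInt (coeff i (map (fromℤ K) cs ++ 1# ∷ []))
  int-coeff-monicPoly []       zero    = int-1
  int-coeff-monicPoly []       (suc i) = int-0
  int-coeff-monicPoly (z ∷ cs) zero    = z , ≈-refl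
  int-coeff-monicPoly (z ∷ cs) (suc i) = int-coeff-monicPoly cs i

  coeff-cong : ∀ {p q} → Pointwise _≈_ p q → ∀ i → coeff i p ≈ coeff i q
  coeff-cong []          i       = ≈-refl
  coeff-cong (a≈b ∷ p≈q) zero    = a≈b
  coeff-cong (a≈b ∷ p≈q) (suc i) = coeff-cong p≈q i

theorem8p2 : ∀ {c ℓ : Level} (K : CommutativeRing c ℓ) → IsField K → CharZero K →
    ∀ (d : ℕ) (cs : Vec ℤ d) (α : Vec (CommutativeRing.Carrier K) d) →
    AreRoots K cs α →
    ∀ (n : ℕ) → 1 < n → (ω : CommutativeRing.Carrier K) → IsPrimitiveRoot K n ω →
    ∃ λ (m : ℤ) → CommutativeRing._≈_ K (Ψ K n ω (toList α))
    (CommutativeRing._*_ K (fromℤ K m) (fromℤ K m))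
theorem8p2 K isField charZero d cs α roots n 1<n ω isPrimitive = proj₁ int-R , (begin
  Ψ K n ω as
    ≡⟨ ∏-foldr (pairs K as) _ ⟩
  ∏ (pairs K as) (λ (a , b) → homCyc K n ω a b * homCyc K n ω a b)
    ≈⟨ ∏-pairs _ as ⟩
  pairProduct (λ a b → homCyc K n ω a b * homCyc K n ω a b) as
    ≈⟨ pairProduct-* (homCyc K n ω) (homCyc K n ω) as ⟩
  pairProduct (homCyc K n ω) as * pairProduct (homCyc K n ω) as
    ≈⟨ *-cong R≈int R≈int ⟩
  fromℤ K (proj₁ int-R) * fromℤ K (proj₁ int-R) ∎)
  where
  open RingLemmas K
  open Integrality K
  open PowerSums K using (int-psum)
  open RootsOfUnity K isField
  open PairProducts K
  open IntegerCoefficients K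
  open import Relation.Binary.Reasoning.Setoid setoid
  open BigOperator *-commutativeMonoid renaming (⨁ to ∏; ⨁-map to ∏-map; ⨁-foldr to ∏-foldr)

  as : List Carrier
  as = toList α

  ζs : List Carrier
  ζs = primitiveRoots n 1<n ω isPrimitive

  binaryForm≡form : ∀ a b → binaryForm ζs a b ≡ form n 1<n ω isPrimitive a b
  binaryForm≡form a b = ∏-map (pow K ω) (coprimeExps K n) (λ ζ → a - ζ * b)

  homCyc≈binaryForm : ∀ a b → homCyc K n ω a b ≈ binaryForm ζs a b
  homCyc≈binaryForm a b = reflexive (≡.trans (∏-foldr (coprimeExps K n) _) (≡.sym (binaryForm≡form a b)))

  binaryForm-symmetric : ∀ a b → binaryForm ζs a b ≈ binaryForm ζs b a
  binaryForm-symmetric a b = ≈-trans (reflexive (binaryForm≡form a b))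
    (≈-trans (form-symmetric n 1<n ω isPrimitive a b) (reflexive (≡.sym (binaryForm≡form b a))))

  int-R : IsInt (pairProduct (binaryForm ζs) as)
  int-R = int-pairProduct ζs as (int-psum-primitiveRoots n 1<n ω isPrimitive)
    -- `roots` equates coefficient lists, so each `e i as` is a coefficient of the given integer
    -- polynomial; this is the input to Newton's identities.
    (int-psum as (λ i → int-resp (≈-sym (coeff-cong roots i)) (int-coeff-monicPoly (toList cs) i)))
    binaryForm-symmetric isField charZero

  R≈int : pairProduct (homCyc K n ω) as ≈ fromℤ K (proj₁ int-R)
  R≈int = ≈-trans (pairProduct-cong homCyc≈binaryForm as) (proj₂ int-R)
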